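{- Let $d\geq 3$. Then there exists $c>0$ such that the following holds. For every positive integer $n$, there exists a family of $n$ axis-parallel boxes in $\mathbb{R}^{d}$ whose intersection graph $G$ contains no clique and no independent set of size larger than $$cn^{1/2}\left(\frac{\log n}{\log\log n}\right)^{ -(d-2)/2}.$$
   Context: Boxes are closed axis-parallel boxes $\prod_{i=1}^d [a_i,b_i]$. The intersection graph of a family of sets has the members of the family as vertices (with multiplicity), two joined by an edge if they have nonempty intersection. The constant $c$ may depend on $d$ only.
   Formalization: Stated for n ≥ 4 instead of every positive integer n (log log n is undefined at n = 1 and negative at n = 2; n = 3 is absorbed by enlarging c); the bound is squared and uses rounded-down binary logarithms, which changes only c. -}

module Defs where

open import Data.Nat using (ℕ; _*_; _^_; _≤_)
open import Data.Nat.Logarithm using (⌊log₂_⌋)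
open import Data.Integer as ℤ using (ℤ)
open import Data.Fin using (Fin)
open import Data.Fin.Subset using (Subset; _∈_)
open import Data.Product using (_×_; proj₁; proj₂)
open import Relation.Binary.PropositionalEquality using (_≢_)
open import Relation.Nullary using (¬_)

Box : ℕ → Set
Box d = Fin d → ℤ × ℤ

lo : ∀ {d} → Box d → Fin d → ℤ
lo B i = proj₁ (B i)

hi : ∀ {d} → Box d → Fin d → ℤ
hi B i = proj₂ (B i)

IsBox : ∀ {d} → Box d → Set
IsBox B = ∀ i → lo B i ℤ.≤ hi B i

Intersect : ∀ {d} → Box d → Box d → Set
Intersect B C = ∀ i → (lo B i ℤ.≤ hi C i) × (lo C i ℤ.≤ hi B i)

-- Intersection graph of a family F : Fin n → Box d (vertices = indices,
-- so multiplicity is respected); cliques and independent sets as vertex subsets.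
IsClique : ∀ {d n} → (Fin n → Box d) → Subset n → Set
IsClique F S = ∀ i j → i ∈ S → j ∈ S → i ≢ j → Intersect (F i) (F j)

IsIndependent : ∀ {d n} → (Fin n → Box d) → Subset n → Set
IsIndependent F S = ∀ i j → i ∈ S → j ∈ S → i ≢ j → ¬ Intersect (F i) (F j)

-- discrete stand-ins for log n and log log n (up to constant factors, n ≥ 4)
L : ℕ → ℕ
L n = ⌊log₂ n ⌋

LL : ℕ → ℕ
LL n = ⌊log₂ ⌊log₂ n ⌋ ⌋

{-# OPTIONS --safe #-}
module Submission where

-- Write d + 1 for the dimension.  Cut [0, b^H)^(d+1) into the b-adic boxes of sides b^(e_0), ..., b^(e_d),
-- for about k^d shapes e with the same sum Σ e_i.  Two such boxes meet iff their digit expansions agree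
-- wherever both prescribe a digit.  Give the box of shape e through y the colour f(w) + h(e), where w
-- collects the digits of y at the positions e_i, and move boxes of different colours apart.
--
-- Cliques: a clique has a common point, which is given by O(d²k) digits, so for random h with values
-- in [Q²] only O(k) of the k^d shapes can have the same colour at one point.
--
-- Independent sets: let Y_e be the union of the boxes of shape e and a fixed colour in the set, and let
-- Z_e consist of the points that, for every i, enter Y_e after changing the digit (i, e_i).  The shapes
-- form an antichain, so that Z_e and Z_e′ are disjoint if e ≠ e′.  On each fibre of the digits (i, e_i)
-- the set Z_e is a cylinder intersection containing Y_e; for random f the colour classes have density
-- about 1/Q² in every cylinder intersection, so Y_e occupies only O(1/Q²) of Z_e, up to a small error.
-- Hence for every colour the Y_e together occupy only O(1/Q²) of the cube.
--
-- With k of order log n / log log n and b a power of log n, repeating the boxes and taking disjoint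
-- copies of the family makes both bounds O(√(n / k^(d-1))).

open import Defs
open import Data.Nat
open import Data.Nat.DivMod
open import Data.Nat.Logarithm
  using (⌊log₂_⌋; ⌊log₂⌋-mono-≤; ⌊log₂⌊n/2⌋⌋≡⌊log₂n⌋∸1; ⌊log₂[2^n]⌋≡n)
open import Data.Nat.Properties
open import Data.Nat.Tactic.RingSolver using (solve-∀)
import Data.Integer as ℤ
import Data.Integer.Properties as ℤ
open import Data.Fin as Fin using (Fin; zero; suc; toℕ; combine)
open import Data.Fin.Properties as Fin
  using (all?; any?; combine-injective; toℕ-injective; toℕ<n; toℕ-fromℕ<) renaming (_≟_ to _≟ᶠ_)
open import Data.Fin.Subset using (Subset; ∣_∣; _∈_; inside; outside)
open import Data.Fin.Subset.Properties using (∣p∣≤n)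
open import Data.Bool using (Bool; true; false; if_then_else_)
open import Data.Bool.Properties using () renaming (_≟_ to _≟ᵇ_)
open import Data.List using (List; []; _∷_; _++_; length; map; cartesianProductWith; cartesianProduct; allFin)
open import Data.List.Properties using (length-tabulate)
open import Data.List.Membership.Propositional using () renaming (_∈_ to _∈ˡ_)
open import Data.List.Membership.Propositional.Properties
  using (∈-cartesianProductWith⁺; ∈-cartesianProduct⁺; ∈-allFin)
open import Data.List.Relation.Unary.All as All using (All; []; _∷_)
open import Data.List.Relation.Unary.AllPairs as AllPairs using (AllPairs; []; _∷_)
open import Data.List.Relation.Unary.Any using (here; there)
open import Data.List.Relation.Unary.Unique.Propositional using (Unique)
import Data.List.Relation.Unary.Unique.Propositional.Properties as Unique
open import Data.Vec as Vec using (Vec; []; _∷_; here; there; lookup; removeAt; insertAt; _[_]≔_)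
import Data.Vec.Properties as Vec
open import Data.Product using (Σ; ∃; _×_; _,_; proj₁; proj₂)
import Data.Product.Properties as Product
open import Data.Sum using (_⊎_; inj₁; inj₂)
open import Data.Empty using (⊥; ⊥-elim)
open import Data.Unit using (⊤; tt)
open import Function using (_∘_; id)
open import Relation.Binary.Definitions using (DecidableEquality)
open import Relation.Binary.PropositionalEquality hiding (J)
open import Relation.Nullary using (¬_; Dec; yes; no; does; _×-dec_; _→-dec_)
open import Relation.Nullary.Decidable using (dec-true; dec-false)

-- Finite sums over lists.

∑ : ∀ {A : Set} → List A → (A → ℕ) → ℕ
∑ []       f = 0
∑ (x ∷ xs) f = f x + ∑ xs f

infix 5 ∑
syntax ∑ xs (λ x → e) = ∑[ x ∈ xs ] e

∑-mono-∈ : ∀ {A : Set} (xs : List A) {f g : A → ℕ} → (∀ {x} → x ∈ˡ xs → f x ≤ g x) → ∑ xs f ≤ ∑ xs g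
∑-mono-∈ []       p = z≤n
∑-mono-∈ (x ∷ xs) p = +-mono-≤ (p (here refl)) (∑-mono-∈ xs (p ∘ there))

∑-mono : ∀ {A : Set} (xs : List A) {f g : A → ℕ} → (∀ x → f x ≤ g x) → ∑ xs f ≤ ∑ xs g
∑-mono xs p = ∑-mono-∈ xs (λ {x} _ → p x)

∑-cong : ∀ {A : Set} (xs : List A) {f g : A → ℕ} → (∀ x → f x ≡ g x) → ∑ xs f ≡ ∑ xs g
∑-cong []       p = refl
∑-cong (x ∷ xs) p = cong₂ _+_ (p x) (∑-cong xs p)

∑-+ : ∀ {A : Set} (xs : List A) (f g : A → ℕ) → ∑[ x ∈ xs ] (f x + g x) ≡ ∑ xs f + ∑ xs g
∑-+ []       f g = refl
∑-+ (x ∷ xs) f g = trans (cong (f x + g x +_) (∑-+ xs f g)) (interchange (f x) (g x) _ _)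
  where
  interchange : ∀ a b c d → (a + b) + (c + d) ≡ (a + c) + (b + d)
  interchange = solve-∀

∑-* : ∀ {A : Set} (xs : List A) c (f : A → ℕ) → ∑[ x ∈ xs ] (c * f x) ≡ c * ∑ xs f
∑-* []       c f = sym (*-zeroʳ c)
∑-* (x ∷ xs) c f = trans (cong (c * f x +_) (∑-* xs c f)) (sym (*-distribˡ-+ c (f x) _))

∑-*ʳ : ∀ {A : Set} (xs : List A) c (f : A → ℕ) → ∑[ x ∈ xs ] (f x * c) ≡ ∑ xs f * c
∑-*ʳ xs c f = trans (∑-cong xs (λ x → *-comm (f x) c)) (trans (∑-* xs c f) (*-comm c _))

∑-const : ∀ {A : Set} (xs : List A) c → ∑[ _ ∈ xs ] c ≡ length xs * c
∑-const []       c = refl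
∑-const (x ∷ xs) c = cong (c +_) (∑-const xs c)

∑-0 : ∀ {A : Set} (xs : List A) → ∑[ _ ∈ xs ] 0 ≡ 0
∑-0 xs = trans (∑-const xs 0) (*-zeroʳ (length xs))

∑-swap : ∀ {A B : Set} (xs : List A) (ys : List B) (f : A → B → ℕ) →
         ∑[ x ∈ xs ] ∑[ y ∈ ys ] f x y ≡ ∑[ y ∈ ys ] ∑[ x ∈ xs ] f x y
∑-swap []       ys f = sym (∑-0 ys)
∑-swap (x ∷ xs) ys f = trans (cong (∑ ys (f x) +_) (∑-swap xs ys f)) (sym (∑-+ ys (f x) _))

∑-++ : ∀ {A : Set} (xs ys : List A) f → ∑ (xs ++ ys) f ≡ ∑ xs f + ∑ ys f
∑-++ []       ys f = refl
∑-++ (x ∷ xs) ys f = trans (cong (f x +_) (∑-++ xs ys f)) (sym (+-assoc (f x) _ _))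

∑-map : ∀ {A B : Set} (h : A → B) xs f → ∑ (map h xs) f ≡ ∑ xs (f ∘ h)
∑-map h []       f = refl
∑-map h (x ∷ xs) f = cong (f (h x) +_) (∑-map h xs f)

∑-cartesianProductWith : ∀ {A B C : Set} (h : A → B → C) xs ys f →
  ∑ (cartesianProductWith h xs ys) f ≡ ∑[ x ∈ xs ] ∑[ y ∈ ys ] f (h x y)
∑-cartesianProductWith h []       ys f = refl
∑-cartesianProductWith h (x ∷ xs) ys f =
  trans (∑-++ (map (h x) ys) _ f) (cong₂ _+_ (∑-map (h x) ys f) (∑-cartesianProductWith h xs ys f))

length≡∑ : ∀ {A : Set} (xs : List A) → length xs ≡ ∑[ _ ∈ xs ] 1
length≡∑ xs = sym (trans (∑-const xs 1) (*-identityʳ _))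

length-cartesianProductWith : ∀ {A B C : Set} (h : A → B → C) xs ys →
  length (cartesianProductWith h xs ys) ≡ length xs * length ys
length-cartesianProductWith h xs ys = begin
  length (cartesianProductWith h xs ys)   ≡⟨ length≡∑ (cartesianProductWith h xs ys) ⟩
  ∑[ _ ∈ cartesianProductWith h xs ys ] 1 ≡⟨ ∑-cartesianProductWith h xs ys _ ⟩
  ∑[ _ ∈ xs ] ∑[ _ ∈ ys ] 1               ≡⟨ ∑-cong xs (λ _ → sym (length≡∑ ys)) ⟩
  ∑[ _ ∈ xs ] length ys                   ≡⟨ ∑-const xs _ ⟩
  length xs * length ys                   ∎
  where open ≡-Reasoning

≤-∑ : ∀ {A : Set} {xs : List A} {x} (f : A → ℕ) → x ∈ˡ xs → f x ≤ ∑ xs f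
≤-∑ f (here refl)              = m≤m+n _ _
≤-∑ {xs = y ∷ xs} f (there x∈) = ≤-trans (≤-∑ f x∈) (m≤n+m _ (f y))

-- Indicators of decidable propositions; enumeration of vectors.

⟦_⟧ : ∀ {p} {P : Set p} → Dec P → ℕ
⟦ yes _ ⟧ = 1
⟦ no  _ ⟧ = 0


⟦⟧-yes : ∀ {P : Set} → (P? : Dec P) → P → ⟦ P? ⟧ ≡ 1
⟦⟧-yes (yes _) p = refl
⟦⟧-yes (no ¬p) p = ⊥-elim (¬p p)

⟦⟧-no : ∀ {P : Set} → (P? : Dec P) → ¬ P → ⟦ P? ⟧ ≡ 0
⟦⟧-no (yes p) ¬p = ⊥-elim (¬p p)
⟦⟧-no (no _)  ¬p = refl

⟦⟧-mono : ∀ {P Q : Set} → (P? : Dec P) (Q? : Dec Q) → (P → Q) → ⟦ P? ⟧ ≤ ⟦ Q? ⟧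
⟦⟧-mono (yes p) Q? f = ≤-reflexive (sym (⟦⟧-yes Q? (f p)))
⟦⟧-mono (no _)  Q? f = z≤n

⟦⟧-cong : ∀ {P Q : Set} → (P? : Dec P) (Q? : Dec Q) → (P → Q) → (Q → P) → ⟦ P? ⟧ ≡ ⟦ Q? ⟧
⟦⟧-cong P? Q? f g = ≤-antisym (⟦⟧-mono P? Q? f) (⟦⟧-mono Q? P? g)

⟦⟧-× : ∀ {P Q : Set} → (P? : Dec P) (Q? : Dec Q) → ⟦ P? ×-dec Q? ⟧ ≡ ⟦ P? ⟧ * ⟦ Q? ⟧
⟦⟧-× (yes _) (yes _) = refl
⟦⟧-× (yes _) (no _)  = refl
⟦⟧-× (no _)  Q?      = refl

⟦⟧-pos : ∀ {P : Set} → (P? : Dec P) → 1 ≤ ⟦ P? ⟧ → P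
⟦⟧-pos (yes p) _ = p

∑-pos : ∀ {A : Set} (xs : List A) f → 1 ≤ ∑ xs f → ∃ λ x → x ∈ˡ xs × 1 ≤ f x
∑-pos (x ∷ xs) f 1≤ with f x in eq
... | suc n = x , here refl , subst (1 ≤_) (sym eq) (s≤s z≤n)
... | zero  with y , y∈ , 1≤y ← ∑-pos xs f 1≤ = y , there y∈ , 1≤y

∑-⟦⟧-≤1 : ∀ {A : Set} {xs : List A} {P : A → Set} (P? : ∀ x → Dec (P x)) →
          AllPairs (λ x y → ¬ (P x × P y)) xs → ∑[ x ∈ xs ] ⟦ P? x ⟧ ≤ 1
∑-⟦⟧-≤1 P? []             = z≤n
∑-⟦⟧-≤1 {xs = x ∷ xs} P? (px ∷ pxs) with P? x
... | no  _ = ∑-⟦⟧-≤1 P? pxs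
... | yes p = s≤s (≤-reflexive (zeros px))
  where
  zeros : ∀ {ys} → All (λ y → ¬ (_ × _)) ys → ∑[ y ∈ ys ] ⟦ P? y ⟧ ≡ 0
  zeros []         = refl
  zeros {y ∷ ys} (q ∷ qs) = cong₂ _+_ (⟦⟧-no (P? y) (λ py → q (p , py))) (zeros qs)

allVecs : ∀ {A : Set} → List A → (n : ℕ) → List (Vec A n)
allVecs xs zero    = [] ∷ []
allVecs xs (suc n) = cartesianProductWith _∷_ xs (allVecs xs n)

∑-allVecs : ∀ {A : Set} (xs : List A) n (f : Vec A (suc n) → ℕ) →
            ∑ (allVecs xs (suc n)) f ≡ ∑[ x ∈ xs ] ∑[ v ∈ allVecs xs n ] f (x ∷ v)
∑-allVecs xs n = ∑-cartesianProductWith _∷_ xs (allVecs xs n)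

∈-allVecs : ∀ {A : Set} {xs : List A} → (∀ x → x ∈ˡ xs) → ∀ {n} (v : Vec A n) → v ∈ˡ allVecs xs n
∈-allVecs all []      = here refl
∈-allVecs all (x ∷ v) = ∈-cartesianProductWith⁺ _∷_ (all x) (∈-allVecs all v)

length-allVecs : ∀ {A : Set} (xs : List A) n → length (allVecs xs n) ≡ length xs ^ n
length-allVecs xs zero    = refl
length-allVecs xs (suc n) =
  trans (length-cartesianProductWith _∷_ xs (allVecs xs n)) (cong (length xs *_) (length-allVecs xs n))

unique-allVecs : ∀ {A : Set} {xs : List A} → Unique xs → ∀ n → Unique (allVecs xs n)
unique-allVecs u zero    = [] ∷ []
unique-allVecs u (suc n) =
  Unique.cartesianProductWith⁺ _∷_ (λ { refl → refl , refl }) u (unique-allVecs u n)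

∏ : ∀ {n} → (Fin n → ℕ) → ℕ
∏ {zero}  f = 1
∏ {suc n} f = f zero * ∏ (f ∘ suc)

∏-cong : ∀ {n} {f g : Fin n → ℕ} → (∀ i → f i ≡ g i) → ∏ f ≡ ∏ g
∏-cong {zero}  p = refl
∏-cong {suc n} p = cong₂ _*_ (p zero) (∏-cong (p ∘ suc))

∑-allVecs-∀ : ∀ {A : Set} (xs : List A) {n} {P : Fin n → A → Set} (P? : ∀ i x → Dec (P i x)) →
  ∑[ v ∈ allVecs xs n ] ⟦ all? (λ i → P? i (lookup v i)) ⟧ ≡ ∏ (λ i → ∑[ x ∈ xs ] ⟦ P? i x ⟧)
∑-allVecs-∀ xs {zero}  P? = cong (_+ 0) (⟦⟧-yes (all? (λ i → P? i (lookup [] i))) (λ ()))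
∑-allVecs-∀ xs {suc n} P? = begin
  ∑ (allVecs xs (suc n)) _
    ≡⟨ ∑-allVecs xs n _ ⟩
  ∑[ x ∈ xs ] ∑[ v ∈ allVecs xs n ] ⟦ all? (λ i → P? i (lookup (x ∷ v) i)) ⟧
    ≡⟨ ∑-cong xs (λ x → trans (∑-cong (allVecs xs n) (split x)) (∑-* (allVecs xs n) ⟦ P? zero x ⟧ _)) ⟩
  ∑[ x ∈ xs ] (⟦ P? zero x ⟧ * (∑[ v ∈ allVecs xs n ] ⟦ all? (λ i → P? (suc i) (lookup v i)) ⟧))
    ≡⟨ ∑-*ʳ xs _ _ ⟩
  (∑[ x ∈ xs ] ⟦ P? zero x ⟧) * (∑[ v ∈ allVecs xs n ] ⟦ all? (λ i → P? (suc i) (lookup v i)) ⟧)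
    ≡⟨ cong ((∑[ x ∈ xs ] ⟦ P? zero x ⟧) *_) (∑-allVecs-∀ xs (P? ∘ suc)) ⟩
  ∏ (λ i → ∑[ x ∈ xs ] ⟦ P? i x ⟧) ∎
  where
  open ≡-Reasoning
  split : ∀ x v → ⟦ all? (λ i → P? i (lookup (x ∷ v) i)) ⟧ ≡
                  ⟦ P? zero x ⟧ * ⟦ all? (λ i → P? (suc i) (lookup v i)) ⟧
  split x v = trans
    (⟦⟧-cong (all? (λ i → P? i (lookup (x ∷ v) i))) (P? zero x ×-dec all? (λ i → P? (suc i) (lookup v i)))
       (λ h → h zero , h ∘ suc) (λ { (h , hs) zero → h ; (h , hs) (suc i) → hs i }))
    (⟦⟧-× (P? zero x) (all? (λ i → P? (suc i) (lookup v i))))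

-- Choosing a function by averaging; exponential moments.

∏ˡ : ∀ {A : Set} → List A → (A → ℕ) → ℕ
∏ˡ []       f = 1
∏ˡ (x ∷ xs) f = f x * ∏ˡ xs f

∏ˡ-cong-∈ : ∀ {A : Set} (xs : List A) {f g} → (∀ {x} → x ∈ˡ xs → f x ≡ g x) → ∏ˡ xs f ≡ ∏ˡ xs g
∏ˡ-cong-∈ []       p = refl
∏ˡ-cong-∈ (x ∷ xs) p = cong₂ _*_ (p (here refl)) (∏ˡ-cong-∈ xs (p ∘ there))

∏ˡ-≤-^ : ∀ {A : Set} (xs : List A) {f} c → (∀ x → f x ≤ c) → ∏ˡ xs f ≤ c ^ length xs
∏ˡ-≤-^ []       c p = ≤-refl
∏ˡ-≤-^ (x ∷ xs) c p = *-mono-≤ (p x) (∏ˡ-≤-^ xs c p)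

minimum-≤-average : ∀ {A : Set} (ys : List A) (g : A → ℕ) → 1 ≤ length ys → ∃ λ y → length ys * g y ≤ ∑ ys g
minimum-≤-average (y ∷ [])           g _ = y , ≤-refl
minimum-≤-average (y ∷ ys@(_ ∷ _)) g _ with z , hz ← minimum-≤-average ys g (s≤s z≤n) | ≤-total (g y) (g z)
... | inj₁ y≤z = y , +-monoʳ-≤ (g y) (≤-trans (*-monoʳ-≤ (length ys) y≤z) hz)
... | inj₂ z≤y = z , +-mono-≤ z≤y hz

length-allFin : ∀ n → length (allFin n) ≡ n
length-allFin n = length-tabulate id

-- The values of G are chosen one point at a time, never letting the conditional expectation of the
-- sum increase; this replaces the choice of a uniformly random G.
choose : ∀ {Ω J : Set} → DecidableEquality Ω → ∀ {r} → 1 ≤ r → (js : List J) (φ : J → Ω → Fin r → ℕ) (xs : List Ω) → Unique xs →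
         ∀ w → ∃ λ (G : Ω → Fin r) →
         r ^ length xs * (∑[ j ∈ js ] (w j * ∏ˡ xs (λ x → φ j x (G x))))
         ≤ ∑[ j ∈ js ] (w j * ∏ˡ xs (λ x → ∑ (allFin r) (φ j x)))
choose _≟_ {suc r} 1≤r js φ [] _ w = (λ _ → zero) , ≤-reflexive (+-identityʳ _)
choose {J = J} _≟_ {r} 1≤r js φ (x ∷ xs) (x∉ ∷ u) w
  with c , hc ← minimum-≤-average (allFin r)
                  (λ c → ∑[ j ∈ js ] (w j * φ j x c * ∏ˡ xs (λ x → ∑ (allFin r) (φ j x))))
                  (subst (1 ≤_) (sym (length-allFin r)) 1≤r)
  with G , hG ← choose _≟_ 1≤r js φ xs u (λ j → w j * φ j x c) = G′ , bound
  where
  G′ : _ → Fin r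
  G′ y = if does (y ≟ x) then c else G y
  G′-x : G′ x ≡ c
  G′-x rewrite dec-true (x ≟ x) refl = refl
  G′-xs : ∀ {y} → y ∈ˡ xs → G′ y ≡ G y
  G′-xs {y} y∈ rewrite dec-false (y ≟ x) (λ { refl → All.lookup x∉ y∈ refl }) = refl
  avg : J → ℕ
  avg j = ∏ˡ xs (λ x → ∑ (allFin r) (φ j x))
  term : ∀ j → w j * ∏ˡ (x ∷ xs) (λ y → φ j y (G′ y)) ≡ w j * φ j x c * ∏ˡ xs (λ y → φ j y (G y))
  term j rewrite G′-x | ∏ˡ-cong-∈ xs {λ y → φ j y (G′ y)} {λ y → φ j y (G y)} (λ y∈ → cong (φ j _) (G′-xs y∈)) =
    sym (*-assoc (w j) _ _)
  open ≤-Reasoning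
  bound : r ^ length (x ∷ xs) * (∑[ j ∈ js ] (w j * ∏ˡ (x ∷ xs) (λ x → φ j x (G′ x))))
          ≤ ∑[ j ∈ js ] (w j * ∏ˡ (x ∷ xs) (λ x → ∑ (allFin r) (φ j x)))
  bound = begin
    r * r ^ length xs * (∑[ j ∈ js ] (w j * ∏ˡ (x ∷ xs) (λ x → φ j x (G′ x))))
      ≡⟨ cong (r * r ^ length xs *_) (∑-cong js term) ⟩
    r * r ^ length xs * (∑[ j ∈ js ] (w j * φ j x c * ∏ˡ xs (λ y → φ j y (G y))))
      ≡⟨ *-assoc r _ _ ⟩
    r * (r ^ length xs * (∑[ j ∈ js ] (w j * φ j x c * ∏ˡ xs (λ y → φ j y (G y)))))
      ≤⟨ *-monoʳ-≤ r hG ⟩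
    r * (∑[ j ∈ js ] (w j * φ j x c * avg j))
      ≡⟨ cong (_* (∑[ j ∈ js ] (w j * φ j x c * avg j))) (sym (length-allFin r)) ⟩
    length (allFin r) * (∑[ j ∈ js ] (w j * φ j x c * avg j))
      ≤⟨ hc ⟩
    ∑[ c ∈ allFin r ] ∑[ j ∈ js ] (w j * φ j x c * avg j)
      ≡⟨ ∑-swap (allFin r) js _ ⟩
    ∑[ j ∈ js ] ∑[ c ∈ allFin r ] (w j * φ j x c * avg j)
      ≡⟨ ∑-cong js (λ j → trans (∑-*ʳ (allFin r) (avg j) _)
           (trans (cong (_* avg j) (∑-* (allFin r) (w j) (φ j x))) (*-assoc (w j) _ _))) ⟩
    ∑[ j ∈ js ] (w j * (∑ (allFin r) (φ j x) * avg j)) ∎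

1≤m^n : ∀ {m} n → 1 ≤ m → 1 ≤ m ^ n
1≤m^n zero    1≤m = ≤-refl
1≤m^n (suc n) 1≤m = *-mono-≤ 1≤m (1≤m^n n 1≤m)

^-distribʳ-* : ∀ n a b → (a * b) ^ n ≡ a ^ n * b ^ n
^-distribʳ-* zero    a b = refl
^-distribʳ-* (suc n) a b = trans (cong (a * b *_) (^-distribʳ-* n a b)) (lem a b (a ^ n) (b ^ n))
  where
  lem : ∀ a b c d → (a * b) * (c * d) ≡ (a * c) * (b * d)
  lem = solve-∀

*-cancelʳ-≤′ : ∀ {m n} o → 1 ≤ o → m * o ≤ n * o → m ≤ n
*-cancelʳ-≤′ (suc o) _ h = *-cancelʳ-≤ _ _ (suc o) h

module _ {Ω J : Set} (_≟_ : DecidableEquality Ω) {r} (1≤r : 1 ≤ r) (ζ : ℕ) {xs : List Ω} (u : Unique xs)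
  (js : List J) {S : J → Ω → Set} {R : J → Ω → Fin r → Set}
  (S? : ∀ j x → Dec (S j x)) (R? : ∀ j x c → Dec (R j x c))
  (R-unique : ∀ j x → ∑[ c ∈ allFin r ] ⟦ R? j x c ⟧ ≤ 1) where

  size : J → ℕ
  size j = ∑[ x ∈ xs ] ⟦ S? j x ⟧

  agreement : J → (Ω → Fin r) → ℕ
  agreement j G = ∑[ x ∈ xs ] ⟦ S? j x ×-dec R? j x (G x) ⟧

  private
    -- ∏ φ is (1 + ζ) ^ agreement, normalised so that the mean of φ at a point does not depend on S.
    weight : ∀ {P : Set} → Dec P → ℕ → ℕ
    weight (yes _) n = r * (1 + ζ * n)
    weight (no _)  n = r + ζ

    φ : J → Ω → Fin r → ℕ
    φ j x c = weight (S? j x) ⟦ R? j x c ⟧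

    ∑φ≤ : ∀ j x → ∑ (allFin r) (φ j x) ≤ r * (r + ζ)
    ∑φ≤ j x with S? j x
    ... | yes _ = begin
      ∑[ c ∈ allFin r ] (r * (1 + ζ * ⟦ R? j x c ⟧)) ≡⟨ ∑-* (allFin r) r _ ⟩
      r * (∑[ c ∈ allFin r ] (1 + ζ * ⟦ R? j x c ⟧)) ≡⟨ cong (r *_) (∑-+ (allFin r) _ _) ⟩
      r * ((∑[ c ∈ allFin r ] 1) + (∑[ c ∈ allFin r ] (ζ * ⟦ R? j x c ⟧)))
        ≡⟨ cong (r *_) (cong₂ _+_ (trans (sym (length≡∑ (allFin r))) (length-allFin r)) (∑-* (allFin r) ζ _)) ⟩
      r * (r + ζ * (∑[ c ∈ allFin r ] ⟦ R? j x c ⟧))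
        ≤⟨ *-monoʳ-≤ r (+-monoʳ-≤ r (≤-trans (*-monoʳ-≤ ζ (R-unique j x)) (≤-reflexive (*-identityʳ ζ)))) ⟩
      r * (r + ζ) ∎
      where open ≤-Reasoning
    ... | no _ = ≤-reflexive (trans (∑-const (allFin r) (r + ζ)) (cong (_* (r + ζ)) (length-allFin r)))

    φ-factor : ∀ j (G : Ω → Fin r) x → φ j x (G x) * (r + ζ) ^ ⟦ S? j x ⟧ ≡
               (r ^ ⟦ S? j x ⟧ * (1 + ζ) ^ ⟦ S? j x ×-dec R? j x (G x) ⟧) * (r + ζ)
    φ-factor j G x with S? j x | R? j x (G x)
    ... | yes _ | yes _ = lem r ζ
      where
      lem : ∀ r ζ → r * (1 + ζ * 1) * ((r + ζ) * 1) ≡ (r * 1 * ((1 + ζ) * 1)) * (r + ζ)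
      lem = solve-∀
    ... | yes _ | no _ = lem r ζ
      where
      lem : ∀ r ζ → r * (1 + ζ * 0) * ((r + ζ) * 1) ≡ (r * 1 * 1) * (r + ζ)
      lem = solve-∀
    ... | no _ | _ = lem r ζ
      where
      lem : ∀ r ζ → (r + ζ) * 1 ≡ 1 * (r + ζ)
      lem = solve-∀

    ∏φ : ∀ j (G : Ω → Fin r) ys → ∏ˡ ys (λ x → φ j x (G x)) * (r + ζ) ^ (∑[ x ∈ ys ] ⟦ S? j x ⟧) ≡
         (r ^ (∑[ x ∈ ys ] ⟦ S? j x ⟧) * (1 + ζ) ^ (∑[ x ∈ ys ] ⟦ S? j x ×-dec R? j x (G x) ⟧)) * (r + ζ) ^ length ys
    ∏φ j G []       = refl
    ∏φ j G (y ∷ ys) = begin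
      (φ j y (G y) * p) * q ^ (m + M)          ≡⟨ cong ((φ j y (G y) * p) *_) (^-distribˡ-+-* q m M) ⟩
      (φ j y (G y) * p) * (q ^ m * q ^ M)      ≡⟨ lem₁ (φ j y (G y)) p (q ^ m) (q ^ M) ⟩
      (φ j y (G y) * q ^ m) * (p * q ^ M)      ≡⟨ cong₂ _*_ (φ-factor j G y) (∏φ j G ys) ⟩
      ((r ^ m * z ^ n) * q) * ((r ^ M * z ^ N) * q ^ length ys)
        ≡⟨ lem₂ (r ^ m) (z ^ n) q (r ^ M) (z ^ N) (q ^ length ys) ⟩
      ((r ^ m * r ^ M) * (z ^ n * z ^ N)) * (q * q ^ length ys)
        ≡⟨ cong (_* (q * q ^ length ys)) (sym (cong₂ _*_ (^-distribˡ-+-* r m M) (^-distribˡ-+-* z n N))) ⟩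
      (r ^ (m + M) * z ^ (n + N)) * (q * q ^ length ys) ∎
      where
      open ≡-Reasoning
      q z p m M n N : ℕ
      q = r + ζ
      z = 1 + ζ
      p = ∏ˡ ys (λ x → φ j x (G x))
      m = ⟦ S? j y ⟧
      M = ∑[ x ∈ ys ] ⟦ S? j x ⟧
      n = ⟦ S? j y ×-dec R? j y (G y) ⟧
      N = ∑[ x ∈ ys ] ⟦ S? j x ×-dec R? j x (G x) ⟧
      lem₁ : ∀ a b c d → (a * b) * (c * d) ≡ (a * c) * (b * d)
      lem₁ = solve-∀
      lem₂ : ∀ a b c d e f → ((a * b) * c) * ((d * e) * f) ≡ ((a * d) * (b * e)) * (c * f)
      lem₂ = solve-∀

  -- Exponential moments with a union bound over `js`: for uniformly random `G` the expectation of
  -- `(1 + ζ) ^ agreement j G` is at most `(1 + ζ / r) ^ size j`, because at each point at most one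
  -- of the `r` values is an agreement. A single `G` then stays within the factor `length js` of
  -- this for all `j` at once. Powers of `r` clear the denominators.
  few-agreements : ∃ λ (G : Ω → Fin r) → ∀ {j} → j ∈ˡ js →
    r ^ size j * (1 + ζ) ^ agreement j G ≤ length js * (r + ζ) ^ size j
  few-agreements with G , hG ← choose _≟_ 1≤r js φ xs u (λ _ → 1) = G , λ {j} → bound j
    where
    open ≤-Reasoning
    M q : ℕ
    M = length xs
    q = r + ζ
    1≤q : 1 ≤ q
    1≤q = ≤-trans 1≤r (m≤m+n r ζ)
    ∏≤ : ∀ j → j ∈ˡ js → ∏ˡ xs (λ x → φ j x (G x)) ≤ length js * q ^ M
    ∏≤ j j∈ = *-cancelʳ-≤′ (r ^ M) (1≤m^n M 1≤r) (begin
      ∏ˡ xs (λ x → φ j x (G x)) * r ^ M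
        ≡⟨ *-comm _ (r ^ M) ⟩
      r ^ M * ∏ˡ xs (λ x → φ j x (G x))
        ≡⟨ cong (r ^ M *_) (sym (*-identityˡ _)) ⟩
      r ^ M * (1 * ∏ˡ xs (λ x → φ j x (G x)))
        ≤⟨ *-monoʳ-≤ (r ^ M) (≤-∑ (λ j → 1 * ∏ˡ xs (λ x → φ j x (G x))) j∈) ⟩
      r ^ M * (∑[ j ∈ js ] (1 * ∏ˡ xs (λ x → φ j x (G x))))
        ≤⟨ hG ⟩
      ∑[ j ∈ js ] (1 * ∏ˡ xs (λ x → ∑ (allFin r) (φ j x)))
        ≤⟨ ∑-mono js (λ j → ≤-trans (≤-reflexive (*-identityˡ _)) (∏ˡ-≤-^ xs (r * q) (∑φ≤ j))) ⟩
      ∑[ j ∈ js ] ((r * q) ^ M)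
        ≡⟨ ∑-const js _ ⟩
      length js * (r * q) ^ M
        ≡⟨ cong (length js *_) (trans (cong (_^ M) (*-comm r q)) (^-distribʳ-* M q r)) ⟩
      length js * (q ^ M * r ^ M)
        ≡⟨ sym (*-assoc (length js) _ _) ⟩
      length js * q ^ M * r ^ M ∎)
    bound : ∀ j → j ∈ˡ js → r ^ size j * (1 + ζ) ^ agreement j G ≤ length js * q ^ size j
    bound j j∈ = *-cancelʳ-≤′ (q ^ M) (1≤m^n M 1≤q) (begin
      r ^ size j * (1 + ζ) ^ agreement j G * q ^ M       ≡⟨ sym (∏φ j G xs) ⟩
      ∏ˡ xs (λ x → φ j x (G x)) * q ^ size j             ≤⟨ *-monoˡ-≤ (q ^ size j) (∏≤ j j∈) ⟩
      length js * q ^ M * q ^ size j                     ≡⟨ *-assoc (length js) _ _ ⟩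
      length js * (q ^ M * q ^ size j)                   ≡⟨ cong (length js *_) (*-comm (q ^ M) _) ⟩
      length js * (q ^ size j * q ^ M)                   ≡⟨ sym (*-assoc (length js) _ _) ⟩
      length js * q ^ size j * q ^ M                     ∎)

-- Boolean functions on a finite list; inequalities for powers.

override : ∀ {A : Set} → DecidableEquality A → A → Bool → (A → Bool) → A → Bool
override _≟_ x v φ y = if does (y ≟ x) then v else φ y

-- Predicates are listed up to agreement on the given list, off which they are `false`; so there are
-- finitely many for any `A`.
allPreds : ∀ {A : Set} → DecidableEquality A → List A → List (A → Bool)
allPreds _≟_ []       = (λ _ → false) ∷ []
allPreds _≟_ (x ∷ xs) =
  cartesianProductWith (override _≟_ x) (true ∷ false ∷ []) (allPreds _≟_ xs)

length-allPreds : ∀ {A : Set} (_≟_ : DecidableEquality A) xs → length (allPreds _≟_ xs) ≡ 2 ^ length xs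
length-allPreds _≟_ []       = refl
length-allPreds _≟_ (x ∷ xs) =
  trans (length-cartesianProductWith (override _≟_ x) (true ∷ false ∷ []) (allPreds _≟_ xs)) (cong (2 *_) (length-allPreds _≟_ xs))

allPreds-complete : ∀ {A : Set} (_≟_ : DecidableEquality A) xs (φ : A → Bool) →
  ∃ λ ψ → ψ ∈ˡ allPreds _≟_ xs × (∀ {y} → y ∈ˡ xs → ψ y ≡ φ y)
allPreds-complete _≟_ []       φ = _ , here refl , λ ()
allPreds-complete {A = A} _≟_ (x ∷ xs) φ with ψ , ψ∈ , eq ← allPreds-complete _≟_ xs φ =
  _ , ∈-cartesianProductWith⁺ (override _≟_ x) (bools (φ x)) ψ∈ , agree
  where
  bools : ∀ v → v ∈ˡ (true ∷ false ∷ [])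
  bools true  = here refl
  bools false = there (here refl)
  agree : ∀ {y} → y ∈ˡ (x ∷ xs) → override _≟_ x (φ x) ψ y ≡ φ y
  agree {y} y∈ with y ≟ x
  agree y∈         | yes refl = refl
  agree (here p)   | no y≢x   = ⊥-elim (y≢x p)
  agree (there y∈) | no _     = eq y∈

allVecs-choice : ∀ {A : Set} {xs : List A} {n} {P : Fin n → A → Set} → (∀ i → ∃ λ x → x ∈ˡ xs × P i x) →
  ∃ λ v → v ∈ˡ allVecs xs n × (∀ i → P i (lookup v i))
allVecs-choice {n = zero}  p = [] , here refl , λ ()
allVecs-choice {n = suc n} p with x , x∈ , px ← p zero | v , v∈ , pv ← allVecs-choice (p ∘ suc) =
  x ∷ v , ∈-cartesianProductWith⁺ _∷_ x∈ v∈ , λ { zero → px ; (suc i) → pv i }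

∑-⟦⟧-unique : ∀ {n} {P : Fin n → Set} (P? : ∀ i → Dec (P i)) → (∀ {i j} → P i → P j → i ≡ j) →
              ∑[ i ∈ allFin n ] ⟦ P? i ⟧ ≤ 1
∑-⟦⟧-unique {n} P? inj =
  ∑-⟦⟧-≤1 P? (AllPairs.map (λ i≢j (pi , pj) → i≢j (inj pi pj)) (Unique.allFin⁺ n))

insertAt-removeAt-≔ : ∀ {A : Set} {n} (v : Vec A (suc n)) i x → insertAt (removeAt v i) i x ≡ v [ i ]≔ x
insertAt-removeAt-≔ (y ∷ v)           zero    x = refl
insertAt-removeAt-≔ (y ∷ v@(_ ∷ _)) (suc i) x = cong (y ∷_) (insertAt-removeAt-≔ v i x)

-- Bernoulli's inequality `(1 + 1/m) ^ j * (1 - j/m) ≤ 1` without fractions, `l` standing for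
-- `m - j`. The induction uses `(m + 1) * l ≤ m * (l + 1)`, which holds as `l ≤ m`.
bernoulli : ∀ j {l m} → j + l ≡ m → suc m ^ j * l ≤ m ^ j * m
bernoulli zero    {l} {m} refl = ≤-refl
bernoulli (suc j) {l} {m} eq   = begin
  suc m * suc m ^ j * l          ≡⟨ lem₁ m (suc m ^ j) l ⟩
  suc m ^ j * (l + m * l)        ≤⟨ *-monoʳ-≤ (suc m ^ j) (+-monoˡ-≤ (m * l) (≤-trans (m≤n+m l (suc j)) (≤-reflexive eq))) ⟩
  suc m ^ j * (m + m * l)        ≡⟨ lem₂ m (suc m ^ j) l ⟩
  m * (suc m ^ j * suc l)        ≤⟨ *-monoʳ-≤ m (bernoulli j (trans (+-suc j l) eq)) ⟩
  m * (m ^ j * m)                ≡⟨ sym (*-assoc m _ m) ⟩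
  m * m ^ j * m                  ∎
  where
  open ≤-Reasoning
  lem₁ : ∀ m a l → suc m * a * l ≡ a * (l + m * l)
  lem₁ = solve-∀
  lem₂ : ∀ m a l → a * (m + m * l) ≡ m * (a * suc l)
  lem₂ = solve-∀

[1+m]^j≤2m^j : ∀ j {m} → 1 ≤ m → j + j ≤ m → suc m ^ j ≤ 2 * m ^ j
[1+m]^j≤2m^j j {m} 1≤m 2j≤m = *-cancelʳ-≤′ m 1≤m (begin
  suc m ^ j * m               ≤⟨ *-monoʳ-≤ (suc m ^ j) m≤2l ⟩
  suc m ^ j * (2 * (m ∸ j))   ≡⟨ lem (suc m ^ j) (m ∸ j) ⟩
  2 * (suc m ^ j * (m ∸ j))   ≤⟨ *-monoʳ-≤ 2 (bernoulli j j+l≡m) ⟩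
  2 * (m ^ j * m)             ≡⟨ sym (*-assoc 2 (m ^ j) m) ⟩
  2 * m ^ j * m               ∎)
  where
  open ≤-Reasoning
  j+l≡m : j + (m ∸ j) ≡ m
  j+l≡m = m+[n∸m]≡n (≤-trans (m≤m+n j j) 2j≤m)
  m≤2l : m ≤ 2 * (m ∸ j)
  m≤2l = begin
    m                      ≡⟨ sym j+l≡m ⟩
    j + (m ∸ j)            ≤⟨ +-monoˡ-≤ (m ∸ j) (m+n≤o⇒m≤o∸n j 2j≤m) ⟩
    (m ∸ j) + (m ∸ j)      ≡⟨ cong ((m ∸ j) +_) (sym (+-identityʳ _)) ⟩
    2 * (m ∸ j)            ∎
  lem : ∀ a b → a * (2 * b) ≡ 2 * (a * b)
  lem = solve-∀

^-cancelʳ-≤ : ∀ m {a b} → 2 ≤ m → m ^ a ≤ m ^ b → a ≤ b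
^-cancelʳ-≤ m {a} {b} 2≤m h with a ≤? b
... | yes a≤b = a≤b
... | no  a≰b = ⊥-elim (<⇒≱ (^-monoʳ-< m 2≤m (≰⇒> a≰b)) h)

-- Colourings of words that are balanced on cylinder intersections.

module _ {b d : ℕ} where

  -- A cylinder in direction `i` is a set of words in which membership does not depend on the letter
  -- `i`. The hull intersects, over all `i`, the smallest such cylinders containing `P`; it is the
  -- smallest cylinder intersection containing `P`.
  CylinderHull : (Vec (Fin b) d → Set) → Vec (Fin b) d → Set
  CylinderHull P w = ∀ i → ∃ λ s → P (w [ i ]≔ s)

  cylinderHull? : ∀ {P} → (∀ w → Dec (P w)) → ∀ w → Dec (CylinderHull P w)
  cylinderHull? P? w = all? (λ i → any? (λ s → P? (w [ i ]≔ s)))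

module _ (b d s τ : ℕ) (1≤s : 1 ≤ s) where

  private
    r : ℕ
    r = s + s
    Word Line : Set
    Word = Vec (Fin b) (suc d)
    Line = Vec (Fin b) d

    lines : List Line
    lines = allVecs (allFin b) d

    _≟ˡ_ : DecidableEquality Line
    _≟ˡ_ = Vec.≡-dec _≟ᶠ_

    J : Set
    J = Fin (r + r) × Vec (Line → Bool) (suc d)

    js : List J
    js = cartesianProduct (allFin (r + r)) (allVecs (allPreds _≟ˡ_ lines) (suc d))

    S : J → Word → Set
    S (_ , Ψ) w = ∀ i → lookup Ψ i (removeAt w i) ≡ true

    S? : ∀ j w → Dec (S j w)
    S? (_ , Ψ) w = all? (λ i → lookup Ψ i (removeAt w i) ≟ᵇ true)

    R? : ∀ (j : J) (w : Word) (c : Fin r) → Dec (toℕ c ≡ toℕ (proj₁ j))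
    R? (ρ , _) w c = toℕ c ≟ toℕ ρ

    length-js : length js ≡ (r + r) * (2 ^ (b ^ d)) ^ suc d
    length-js = begin
      length js
        ≡⟨ length-cartesianProductWith _,_ (allFin (r + r)) _ ⟩
      length (allFin (r + r)) * length (allVecs (allPreds _≟ˡ_ lines) (suc d))
        ≡⟨ cong₂ _*_ (length-allFin (r + r)) (length-allVecs (allPreds _≟ˡ_ lines) (suc d)) ⟩
      (r + r) * length (allPreds _≟ˡ_ lines) ^ suc d
        ≡⟨ cong (λ n → (r + r) * n ^ suc d) (trans (length-allPreds _≟ˡ_ lines) (cong (2 ^_) length-lines)) ⟩
      (r + r) * (2 ^ (b ^ d)) ^ suc d ∎
      where
      open ≡-Reasoning
      length-lines : length lines ≡ b ^ d
      length-lines = trans (length-allVecs (allFin b) d) (cong (_^ d) (length-allFin b))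

  words : List Word
  words = allVecs (allFin b) (suc d)

  -- The hypothesis bounds the number of events by `2 ^ τ`. For a suitable `f`, a colour taken by
  -- `p` words of a cylinder intersection of `N` words always satisfies
  -- `2 ^ p ≤ 2 ^ τ * (1 + 1/r) ^ N`, and the hull of `P` is one of these intersections.
  balanced-colouring : (r + r) * (2 ^ (b ^ d)) ^ suc d ≤ 2 ^ τ →
    ∃ λ (f : Word → Fin r) → ∀ {P : Word → Set} (P? : ∀ w → Dec (P w)) {ρ} → ρ < r + r →
      (∀ w → P w → toℕ (f w) ≡ ρ) →
      s * (∑[ w ∈ words ] ⟦ P? w ⟧) ≤ (∑[ w ∈ words ] ⟦ cylinderHull? P? w ⟧) + s * τ
  balanced-colouring T≤ = f , bound
    where
    random : ∃ λ (f : Word → Fin r) → ∀ {j} → j ∈ˡ js →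
      r ^ (∑[ w ∈ words ] ⟦ S? j w ⟧) * 2 ^ (∑[ w ∈ words ] ⟦ S? j w ×-dec R? j w (f w) ⟧)
      ≤ length js * (r + 1) ^ (∑[ w ∈ words ] ⟦ S? j w ⟧)
    -- `ζ = 1`, so that each agreement counts as a factor 2.
    random = few-agreements (Vec.≡-dec _≟ᶠ_) (≤-trans 1≤s (m≤m+n s s)) 1
               (unique-allVecs (Unique.allFin⁺ b) (suc d)) js S? R?
               (λ j w → ∑-⟦⟧-unique (R? j w) (λ p q → toℕ-injective (trans p (sym q))))
    f : Word → Fin r
    f = proj₁ random
    bound : ∀ {P : Word → Set} (P? : ∀ w → Dec (P w)) {ρ} → ρ < r + r →
      (∀ w → P w → toℕ (f w) ≡ ρ) →
      s * (∑[ w ∈ words ] ⟦ P? w ⟧) ≤ (∑[ w ∈ words ] ⟦ cylinderHull? P? w ⟧) + s * τ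
    -- Both sides of `main` are raised to the power `s`: as `r = 2 s`, `(1 + 1/r) ^ s ≤ 2`, and
    -- comparing exponents of 2 gives `s * p ≤ N + s * τ`.
    bound {P} P? {ρ} ρ<2r f≡ρ = ^-cancelʳ-≤ 2 ≤-refl (*-cancelʳ-≤′ ((r ^ s) ^ N) (1≤m^n N (1≤m^n s 1≤r)) (begin
        2 ^ (s * p) * (r ^ s) ^ N         ≡⟨ cong₂ _*_ (trans (cong (2 ^_) (*-comm s p)) (sym (^-*-assoc 2 p s))) (swap-^ r) ⟩
        (2 ^ p) ^ s * (r ^ N) ^ s         ≡⟨ sym (^-distribʳ-* s (2 ^ p) (r ^ N)) ⟩
        (2 ^ p * r ^ N) ^ s               ≤⟨ ^-monoˡ-≤ s main ⟩
        (2 ^ τ * suc r ^ N) ^ s           ≡⟨ ^-distribʳ-* s (2 ^ τ) (suc r ^ N) ⟩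
        (2 ^ τ) ^ s * (suc r ^ N) ^ s     ≡⟨ cong₂ _*_ (trans (^-*-assoc 2 τ s) (cong (2 ^_) (*-comm τ s))) (sym (swap-^ (suc r))) ⟩
        2 ^ (s * τ) * (suc r ^ s) ^ N     ≤⟨ *-monoʳ-≤ (2 ^ (s * τ)) (^-monoˡ-≤ N ([1+m]^j≤2m^j s 1≤r ≤-refl)) ⟩
        2 ^ (s * τ) * (2 * r ^ s) ^ N     ≡⟨ cong (2 ^ (s * τ) *_) (^-distribʳ-* N 2 (r ^ s)) ⟩
        2 ^ (s * τ) * (2 ^ N * (r ^ s) ^ N) ≡⟨ sym (*-assoc (2 ^ (s * τ)) _ _) ⟩
        2 ^ (s * τ) * 2 ^ N * (r ^ s) ^ N ≡⟨ cong (_* (r ^ s) ^ N) (trans (sym (^-distribˡ-+-* 2 (s * τ) N)) (cong (2 ^_) (+-comm (s * τ) N))) ⟩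
        2 ^ (N + s * τ) * (r ^ s) ^ N     ∎))
      where
      open ≤-Reasoning
      1≤r : 1 ≤ r
      1≤r = ≤-trans 1≤s (m≤m+n s s)
      N p : ℕ
      N = ∑[ w ∈ words ] ⟦ cylinderHull? P? w ⟧
      p = ∑[ w ∈ words ] ⟦ P? w ⟧
      swap-^ : ∀ a → (a ^ s) ^ N ≡ (a ^ N) ^ s
      swap-^ a = trans (^-*-assoc a s N) (trans (cong (a ^_) (*-comm s N)) (sym (^-*-assoc a N s)))
      ρ′ : Fin (r + r)
      ρ′ = Fin.fromℕ< ρ<2r
      shadow? : ∀ i (l : Line) → Dec (∃ λ x → P (insertAt l i x))
      shadow? i l = any? (λ x → P? (insertAt l i x))
      -- In direction `i` the shadow of `P` is taken, so that `S j` is exactly the cylinder hull of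
      -- `P`.
      family : ∃ λ Ψ → Ψ ∈ˡ allVecs (allPreds _≟ˡ_ lines) (suc d) × (∀ i l → lookup Ψ i l ≡ does (shadow? i l))
      family = allVecs-choice {P = λ i ψ → ∀ l → ψ l ≡ does (shadow? i l)} (λ i →
        let ψ , ψ∈ , eq = allPreds-complete _≟ˡ_ lines (λ l → does (shadow? i l))
        in ψ , ψ∈ , λ l → eq (∈-allVecs ∈-allFin l))
      j : J
      j = ρ′ , proj₁ family
      j∈ : j ∈ˡ js
      j∈ = ∈-cartesianProduct⁺ (∈-allFin ρ′) (proj₁ (proj₂ family))
      S⇒hull : ∀ w → S j w → CylinderHull P w
      S⇒hull w sw i with shadow? i (removeAt w i) | trans (sym (proj₂ (proj₂ family) i (removeAt w i))) (sw i)
      ... | yes (x , px) | _ = x , subst P (insertAt-removeAt-≔ w i x) px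
      hull⇒S : ∀ w → CylinderHull P w → S j w
      hull⇒S w hw i = trans (proj₂ (proj₂ family) i (removeAt w i))
        (dec-true (shadow? i (removeAt w i)) (proj₁ (hw i) , subst P (sym (insertAt-removeAt-≔ w i _)) (proj₂ (hw i))))
      P⇒hull : ∀ w → P w → CylinderHull P w
      P⇒hull w pw i = lookup w i , subst P (sym (Vec.[]≔-lookup w i)) pw
      size≡ : ∑[ w ∈ words ] ⟦ S? j w ⟧ ≡ N
      size≡ = ∑-cong words (λ w → ⟦⟧-cong (S? j w) (cylinderHull? P? w) (S⇒hull w) (hull⇒S w))
      a : ℕ
      a = ∑[ w ∈ words ] ⟦ S? j w ×-dec R? j w (f w) ⟧
      main : 2 ^ p * r ^ N ≤ 2 ^ τ * suc r ^ N
      main = begin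
        2 ^ p * r ^ N
          ≤⟨ *-monoˡ-≤ (r ^ N) (^-monoʳ-≤ 2 (∑-mono words (λ w → ⟦⟧-mono (P? w) (S? j w ×-dec R? j w (f w))
               (λ pw → hull⇒S w (P⇒hull w pw) , trans (f≡ρ w pw) (sym (toℕ-fromℕ< ρ<2r)))))) ⟩
        2 ^ a * r ^ N
          ≡⟨ trans (*-comm (2 ^ a) (r ^ N)) (cong (λ n → r ^ n * 2 ^ a) (sym size≡)) ⟩
        r ^ (∑[ w ∈ words ] ⟦ S? j w ⟧) * 2 ^ a
          ≤⟨ proj₂ random j∈ ⟩
        length js * (r + 1) ^ (∑[ w ∈ words ] ⟦ S? j w ⟧)
          ≡⟨ cong₂ _*_ length-js (cong₂ _^_ (+-comm r 1) size≡) ⟩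
        (r + r) * (2 ^ (b ^ d)) ^ suc d * suc r ^ N
          ≤⟨ *-monoˡ-≤ (suc r ^ N) T≤ ⟩
        2 ^ τ * suc r ^ N ∎

-- Points of the cube as digit vectors, and their b-adic tiles.

module _ {b H : ℕ} where

  -- Each coordinate is a number of `H` digits in base `b`, least significant digit first.
  Point : ℕ → Set
  Point n = Vec (Vec (Fin b) H) n

  points : ∀ n → List (Point n)
  points n = allVecs (allVecs (allFin b) H) n

  digits : ∀ {n} → (Fin n → Fin H) → Point n → Vec (Fin b) n
  digits e []      = []
  digits e (x ∷ y) = lookup x (e zero) ∷ digits (e ∘ suc) y

  setDigits : ∀ {n} → (Fin n → Fin H) → Vec (Fin b) n → Point n → Point n
  setDigits e []      []      = []
  setDigits e (s ∷ w) (x ∷ y) = (x [ e zero ]≔ s) ∷ setDigits (e ∘ suc) w y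

  lookup-digits : ∀ {n} (e : Fin n → Fin H) y i → lookup (digits e y) i ≡ lookup (lookup y i) (e i)
  lookup-digits e (x ∷ y) zero    = refl
  lookup-digits e (x ∷ y) (suc i) = lookup-digits (e ∘ suc) y i

  lookup-setDigits : ∀ {n} (e : Fin n → Fin H) w y i →
                     lookup (setDigits e w y) i ≡ (lookup y i [ e i ]≔ lookup w i)
  lookup-setDigits e (s ∷ w) (x ∷ y) zero    = refl
  lookup-setDigits e (s ∷ w) (x ∷ y) (suc i) = lookup-setDigits (e ∘ suc) w y i

  digits-cong : ∀ {n} (e : Fin n → Fin H) y y′ →
                (∀ i → lookup (lookup y i) (e i) ≡ lookup (lookup y′ i) (e i)) → digits e y ≡ digits e y′
  digits-cong e []      []        p = refl
  digits-cong e (x ∷ y) (x′ ∷ y′) p = cong₂ _∷_ (p zero) (digits-cong (e ∘ suc) y y′ (p ∘ suc))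

  digits-setDigits : ∀ {n} (e : Fin n → Fin H) w y → digits e (setDigits e w y) ≡ w
  digits-setDigits e []      []      = refl
  digits-setDigits e (s ∷ w) (x ∷ y) = cong₂ _∷_ (Vec.lookup∘update (e zero) x s) (digits-setDigits (e ∘ suc) w y)

  setDigits-setDigits : ∀ {n} (e : Fin n → Fin H) w w′ y → setDigits e w′ (setDigits e w y) ≡ setDigits e w′ y
  setDigits-setDigits e []      []        []      = refl
  setDigits-setDigits e (s ∷ w) (s′ ∷ w′) (x ∷ y) =
    cong₂ _∷_ (Vec.[]≔-idempotent x (e zero)) (setDigits-setDigits (e ∘ suc) w w′ y)

  ∑-update : ∀ {n} (p : Fin n) (g : Vec (Fin b) n → ℕ) →
             ∑[ x ∈ allVecs (allFin b) n ] ∑[ s ∈ allFin b ] g (x [ p ]≔ s) ≡ b * ∑ (allVecs (allFin b) n) g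
  ∑-update {suc n} zero g = begin
    ∑[ x ∈ allVecs (allFin b) (suc n) ] ∑[ s ∈ allFin b ] g (x [ zero ]≔ s)
      ≡⟨ ∑-allVecs (allFin b) n _ ⟩
    ∑[ _ ∈ allFin b ] ∑[ x ∈ allVecs (allFin b) n ] ∑[ s ∈ allFin b ] g (s ∷ x)
      ≡⟨ trans (∑-const (allFin b) _) (cong₂ _*_ (length-allFin b) (∑-swap (allVecs (allFin b) n) (allFin b) _)) ⟩
    b * (∑[ s ∈ allFin b ] ∑[ x ∈ allVecs (allFin b) n ] g (s ∷ x))
      ≡⟨ cong (b *_) (sym (∑-allVecs (allFin b) n g)) ⟩
    b * ∑ (allVecs (allFin b) (suc n)) g ∎
    where open ≡-Reasoning
  ∑-update {suc n} (suc p) g = begin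
    ∑[ x ∈ allVecs (allFin b) (suc n) ] ∑[ s ∈ allFin b ] g (x [ suc p ]≔ s)
      ≡⟨ ∑-allVecs (allFin b) n _ ⟩
    ∑[ t ∈ allFin b ] ∑[ x ∈ allVecs (allFin b) n ] ∑[ s ∈ allFin b ] g (t ∷ (x [ p ]≔ s))
      ≡⟨ ∑-cong (allFin b) (λ t → ∑-update p (g ∘ (t ∷_))) ⟩
    ∑[ t ∈ allFin b ] (b * (∑[ x ∈ allVecs (allFin b) n ] g (t ∷ x)))
      ≡⟨ ∑-* (allFin b) b _ ⟩
    b * (∑[ t ∈ allFin b ] ∑[ x ∈ allVecs (allFin b) n ] g (t ∷ x))
      ≡⟨ cong (b *_) (sym (∑-allVecs (allFin b) n g)) ⟩
    b * ∑ (allVecs (allFin b) (suc n)) g ∎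
    where open ≡-Reasoning

  -- Every point arises from exactly `b ^ n` pairs of `y` and `w`: it determines `w`, and the `n`
  -- overwritten digits of `y` are arbitrary.
  ∑-setDigits : ∀ {n} (e : Fin n → Fin H) (g : Point n → ℕ) →
    ∑[ y ∈ points n ] ∑[ w ∈ allVecs (allFin b) n ] g (setDigits e w y) ≡ b ^ n * ∑ (points n) g
  ∑-setDigits {zero}  e g = lem (g [])
    where
    lem : ∀ a → ((a + 0) + 0) ≡ 1 * (a + 0)
    lem = solve-∀
  ∑-setDigits {suc n} e g = begin
    ∑[ y ∈ points (suc n) ] ∑[ w ∈ allVecs (allFin b) (suc n) ] g (setDigits e w y)
      ≡⟨ ∑-allVecs X n _ ⟩
    ∑[ x ∈ X ] ∑[ y ∈ points n ] ∑[ w ∈ allVecs (allFin b) (suc n) ] g (setDigits e w (x ∷ y))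
      ≡⟨ ∑-cong X (λ x → trans (∑-cong (points n) (λ y → ∑-allVecs (allFin b) n _)) (∑-swap (points n) (allFin b) _)) ⟩
    ∑[ x ∈ X ] ∑[ s ∈ allFin b ] ∑[ y ∈ points n ] ∑[ w ∈ allVecs (allFin b) n ]
      g ((x [ e zero ]≔ s) ∷ setDigits (e ∘ suc) w y)
      ≡⟨ ∑-cong X (λ x → ∑-cong (allFin b) (λ s → ∑-setDigits (e ∘ suc) (λ y → g ((x [ e zero ]≔ s) ∷ y)))) ⟩
    ∑[ x ∈ X ] ∑[ s ∈ allFin b ] G (x [ e zero ]≔ s)
      ≡⟨ ∑-update (e zero) G ⟩
    b * ∑ X G
      ≡⟨ cong (b *_) (∑-* X (b ^ n) _) ⟩
    b * (b ^ n * (∑[ x ∈ X ] ∑[ y ∈ points n ] g (x ∷ y)))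
      ≡⟨ trans (sym (*-assoc b _ _)) (cong (b * b ^ n *_) (sym (∑-allVecs X n g))) ⟩
    b * b ^ n * ∑ (points (suc n)) g ∎
    where
    open ≡-Reasoning
    X : List (Vec (Fin b) H)
    X = allVecs (allFin b) H
    G : Vec (Fin b) H → ℕ
    G x = b ^ n * (∑[ y ∈ points n ] g (x ∷ y))

  -- The b-adic box of sides `b ^ e i` around `x`: digits below position `e i` are free, the others
  -- are prescribed by `x`.
  InTile : ∀ {n} → (Fin n → ℕ) → Point n → Point n → Set
  InTile e x y = ∀ i p → e i ≤ toℕ p → lookup (lookup y i) p ≡ lookup (lookup x i) p

  inTile? : ∀ {n} (e : Fin n → ℕ) x y → Dec (InTile e x y)
  inTile? e x y = all? (λ i → all? (λ p → (e i ≤? toℕ p) →-dec (lookup (lookup y i) p ≟ᶠ lookup (lookup x i) p)))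

∏-threshold : ∀ b {n} e → e ≤ n → (f : Fin n → ℕ) → (∀ p → toℕ p < e → f p ≡ b) → (∀ p → e ≤ toℕ p → f p ≡ 1) →
              ∏ f ≡ b ^ e
∏-threshold b {zero}  zero    _         f lo hi = refl
∏-threshold b {suc n} zero    _         f lo hi =
  cong₂ _*_ (hi zero z≤n) (∏-threshold b zero z≤n (f ∘ suc) (λ _ ()) (λ p _ → hi (suc p) z≤n))
∏-threshold b {suc n} (suc e) (s≤s e≤n) f lo hi =
  cong₂ _*_ (lo zero (s≤s z≤n))
    (∏-threshold b e e≤n (f ∘ suc) (λ p p<e → lo (suc p) (s≤s p<e)) (λ p e≤p → hi (suc p) (s≤s e≤p)))

∑-⟦⟧-all : ∀ {A : Set} {P : A → Set} (P? : ∀ x → Dec (P x)) xs → (∀ x → P x) → ∑[ x ∈ xs ] ⟦ P? x ⟧ ≡ length xs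
∑-⟦⟧-all P? xs p = trans (∑-cong xs (λ x → ⟦⟧-yes (P? x) (p x))) (sym (length≡∑ xs))

tile-size : ∀ {b H n} (e : Fin n → ℕ) → (∀ i → e i ≤ H) → (x : Point n) →
            ∑[ y ∈ points n ] ⟦ inTile? {b} {H} e x y ⟧ ≡ ∏ (λ i → b ^ e i)
tile-size {b} {H} {n} e e≤H x =
  trans (∑-allVecs-∀ (allVecs (allFin b) H) {n} (λ i u → all? (λ p → digit? i p (lookup u p))))
        (∏-cong (λ i → trans (∑-allVecs-∀ (allFin b) (digit? i)) (∏-threshold b (e i) (e≤H i) _ (free i) (fixed i))))
  where
  digit? : ∀ i (p : Fin H) (s : Fin b) → Dec (e i ≤ toℕ p → s ≡ lookup (lookup x i) p)
  digit? i p s = (e i ≤? toℕ p) →-dec (s ≟ᶠ lookup (lookup x i) p)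
  free : ∀ i p → toℕ p < e i → ∑[ s ∈ allFin b ] ⟦ digit? i p s ⟧ ≡ b
  free i p p<e = trans (∑-⟦⟧-all (digit? i p) (allFin b) (λ s e≤p → ⊥-elim (<⇒≱ p<e e≤p))) (length-allFin b)
  fixed : ∀ i p → e i ≤ toℕ p → ∑[ s ∈ allFin b ] ⟦ digit? i p s ⟧ ≡ 1
  fixed i p e≤p = ≤-antisym
    (∑-⟦⟧-unique (digit? i p) (λ q q′ → trans (q e≤p) (sym (q′ e≤p))))
    (≤-trans (≤-reflexive (sym (⟦⟧-yes (digit? i p s₀) (λ _ → refl)))) (≤-∑ (λ s → ⟦ digit? i p s ⟧) (∈-allFin s₀)))
    where
    s₀ : Fin b
    s₀ = lookup (lookup x i) p

-- Shapes and their exponents.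

module _ (d k : ℕ) where

  Shape : Set
  Shape = Vec (Fin k) d

  shapes : List Shape
  shapes = allVecs (allFin k) d

total : ∀ {k n} → Vec (Fin k) n → ℕ
total []      = 0
total (x ∷ a) = toℕ x + total a

total-≤ : ∀ {k n} (a : Vec (Fin k) n) → total a ≤ n * k
total-≤ []      = z≤n
total-≤ (x ∷ a) = +-mono-≤ (<⇒≤ (toℕ<n x)) (total-≤ a)

lookup≤total : ∀ {k n} (a : Vec (Fin k) n) i → toℕ (lookup a i) ≤ total a
lookup≤total (x ∷ a) zero    = m≤m+n _ _
lookup≤total (x ∷ a) (suc i) = ≤-trans (lookup≤total a i) (m≤n+m _ (toℕ x))

total-mono : ∀ {k n} (a a′ : Vec (Fin k) n) → (∀ i → toℕ (lookup a i) ≤ toℕ (lookup a′ i)) → total a ≤ total a′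
total-mono []      []        p = z≤n
total-mono (x ∷ a) (y ∷ a′) p = +-mono-≤ (p zero) (total-mono a a′ (p ∘ suc))

total-rigid : ∀ {k n} (a a′ : Vec (Fin k) n) → (∀ i → toℕ (lookup a i) ≤ toℕ (lookup a′ i)) →
              total a′ ≤ total a → a ≡ a′
total-rigid []      []        p t = refl
total-rigid (x ∷ a) (y ∷ a′) p t = cong₂ _∷_
  (toℕ-injective (≤-antisym (p zero)
    (+-cancelʳ-≤ (total a) _ _ (≤-trans (+-monoʳ-≤ (toℕ y) (total-mono a a′ (p ∘ suc))) t))))
  (total-rigid a a′ (p ∘ suc) (+-cancelˡ-≤ (toℕ x) _ _ (≤-trans (+-monoˡ-≤ (total a′) (p zero)) t)))

module _ {d k : ℕ} where

  -- The exponents e_0, ..., e_d. A shape records only the last `d` of them, each below `k`, and e_0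
  -- makes the sum equal to `d * k`; hence all tiles have the same volume.
  height : Shape d k → Fin (suc d) → ℕ
  height a zero    = d * k ∸ total a
  height a (suc i) = toℕ (lookup a i)

  height-≤ : ∀ a i → height a i ≤ d * k
  height-≤ a zero    = m∸n≤m (d * k) (total a)
  height-≤ a (suc i) = ≤-trans (lookup≤total a i) (total-≤ a)

  -- The position of the lowest prescribed digit. An exponent can be as large as `d * k`, so
  -- coordinates get `suc (d * k)` digits; even then one digit is prescribed.
  level : Shape d k → Fin (suc d) → Fin (suc (d * k))
  level a i = Fin.fromℕ< (s≤s (height-≤ a i))

  toℕ-level : ∀ a i → toℕ (level a i) ≡ height a i
  toℕ-level a i = toℕ-fromℕ< (s≤s (height-≤ a i))

  ∏-height : ∀ b a → ∏ (λ i → b ^ height a i) ≡ b ^ (d * k)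
  ∏-height b a = begin
    b ^ (d * k ∸ total a) * ∏ (λ i → b ^ toℕ (lookup a i)) ≡⟨ cong (b ^ (d * k ∸ total a) *_) (∏-lookup a) ⟩
    b ^ (d * k ∸ total a) * b ^ total a                    ≡⟨ sym (^-distribˡ-+-* b (d * k ∸ total a) (total a)) ⟩
    b ^ (d * k ∸ total a + total a)                        ≡⟨ cong (b ^_) (m∸n+n≡m (total-≤ a)) ⟩
    b ^ (d * k)                                            ∎
    where
    open ≡-Reasoning
    ∏-lookup : ∀ {n} (a : Vec (Fin k) n) → ∏ (λ i → b ^ toℕ (lookup a i)) ≡ b ^ total a
    ∏-lookup []      = refl
    ∏-lookup (x ∷ a) = trans (cong (b ^ toℕ x *_) (∏-lookup a)) (sym (^-distribˡ-+-* b (toℕ x) (total a)))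

  -- Otherwise `a′` lies below `a` in every coordinate; the zeroth coordinate reverses the
  -- comparison of the totals, and `total-rigid` forces equality.
  height-antichain : ∀ a a′ → a ≢ a′ → ∃ λ i → height a i < height a′ i
  height-antichain a a′ a≢a′ with any? (λ i → height a i <? height a′ i)
  ... | yes p = p
  ... | no ¬p = ⊥-elim (a≢a′ (sym (total-rigid a′ a (≤s ∘ suc)
          (∸-cancelʳ-≤ (total-≤ a) (≤s zero)))))
    where
    ≤s : ∀ i → height a′ i ≤ height a i
    ≤s i = ≮⇒≥ (λ lt → ¬p (i , lt))

-- All digits written back, except the one in direction `i`, are those already present in `y`.
setDigits-perturb : ∀ {b H n} (e : Fin n → Fin H) (y : Point {b} n) i s j p → (j ≡ i → p ≢ e i) →
  lookup (lookup (setDigits e (digits e y [ i ]≔ s) y) j) p ≡ lookup (lookup y j) p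
setDigits-perturb e y i s j p p≢
  rewrite lookup-setDigits e (digits e y [ i ]≔ s) y j with j ≟ᶠ i
... | yes refl = Vec.lookup∘update′ (p≢ refl) (lookup y j) _
... | no j≢i
  rewrite Vec.lookup∘update′ j≢i (digits e y) s | lookup-digits e y j = cong (λ x → lookup x p) (Vec.[]≔-lookup (lookup y j) (e j))

-- Colours shared by few shapes at every point.

module _ (d k Q s τ : ℕ) (s+s≡Q² : s + s ≡ Q * Q) (2≤Q : 2 ≤ Q) (2K≤Q : k ^ d + k ^ d ≤ Q) where

  private
    b H r t : ℕ
    b = Q ^ 4
    H = suc (d * k)
    r = s + s
    -- The `b ^ (H * suc d)` points account for the exponent `4 * (H * suc d)` of `Q`, since
    -- `b = Q ^ 4`; the final 4 absorbs the factor `2 * (r + r) = 4 * Q * Q`, as `Q ≥ 2`.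
    t = 4 * (H * suc d) + 4
    1≤s : 1 ≤ s
    1≤s = n≢0⇒n>0 λ { refl → <⇒≢ (*-mono-≤ (≤-trans (s≤s z≤n) 2≤Q) (≤-trans (s≤s z≤n) 2≤Q)) s+s≡Q² }

  -- The colour of a word is `f w + h a`. Balance is inherited from `f`, since for a fixed shape the
  -- shift only renames the classes. Sparsity comes from a random shift `h`, under which each shape
  -- has colour `c` at `y` with probability at most `1 / r`.
  colouring : ((r + r) * (2 ^ (b ^ d)) ^ suc d ≤ 2 ^ τ) →
    ∃ λ (colour : Shape d k → Vec (Fin b) (suc d) → Fin (r + r)) →
      (∀ (y : Point {b} {H} (suc d)) c → ∑[ a ∈ shapes d k ] ⟦ colour a (digits (level a) y) ≟ᶠ c ⟧ ≤ t) ×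
      (∀ a c {P : Vec (Fin b) (suc d) → Set} (P? : ∀ w → Dec (P w)) → (∀ w → P w → colour a w ≡ c) →
        s * (∑[ w ∈ allVecs (allFin b) (suc d) ] ⟦ P? w ⟧)
        ≤ (∑[ w ∈ allVecs (allFin b) (suc d) ] ⟦ cylinderHull? P? w ⟧) + s * τ)
  colouring T≤ = colour , sparse , balanced
    where
    f : Vec (Fin b) (suc d) → Fin r
    f = proj₁ (balanced-colouring b d s τ 1≤s T≤)
    1≤r : 1 ≤ r
    1≤r = ≤-trans 1≤s (m≤m+n s s)
    J : Set
    J = Point {b} {H} (suc d) × Fin (r + r)
    js : List J
    js = cartesianProduct (points {b} {H} (suc d)) (allFin (r + r))
    value : Shape d k → Point (suc d) → ℕ
    value a y = toℕ (f (digits (level a) y))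
    R? : ∀ (j : J) (a : Shape d k) (v : Fin r) → Dec (value a (proj₁ j) + toℕ v ≡ toℕ (proj₂ j))
    R? (y , c) a v = value a y + toℕ v ≟ toℕ c
    shift : ∃ λ (h : Shape d k → Fin r) → ∀ {j} → j ∈ˡ js →
      r ^ (∑[ a ∈ shapes d k ] 1) * (1 + Q) ^ (∑[ a ∈ shapes d k ] ⟦ yes tt ×-dec R? j a (h a) ⟧)
      ≤ length js * (r + Q) ^ (∑[ a ∈ shapes d k ] 1)
    -- With `ζ = Q` and `r = Q * Q` the moment is at most `(1 + 1/Q) ^ (k ^ d) ≤ 2` by `2K≤Q`,
    -- whereas every agreement counts as a factor above `Q`.
    shift = few-agreements (Vec.≡-dec _≟ᶠ_) 1≤r Q (unique-allVecs (Unique.allFin⁺ k) d) js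
              {S = λ _ _ → ⊤} (λ _ _ → yes tt) R?
              (λ j a → ∑-⟦⟧-unique (R? j a) (λ p q → toℕ-injective (+-cancelˡ-≡ (value a (proj₁ j)) _ _ (trans p (sym q)))))
    h : Shape d k → Fin r
    h = proj₁ shift
    sum< : ∀ a w → toℕ (f w) + toℕ (h a) < r + r
    sum< a w = +-mono-< (toℕ<n (f w)) (toℕ<n (h a))
    colour : Shape d k → Vec (Fin b) (suc d) → Fin (r + r)
    -- The sum is not reduced modulo `r`, hence `r + r` colours.
    colour a w = Fin.fromℕ< (sum< a w)
    toℕ-colour : ∀ a w → toℕ (colour a w) ≡ toℕ (f w) + toℕ (h a)
    toℕ-colour a w = toℕ-fromℕ< (sum< a w)

    balanced : ∀ a c {P : Vec (Fin b) (suc d) → Set} (P? : ∀ w → Dec (P w)) → (∀ w → P w → colour a w ≡ c) →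
        s * (∑[ w ∈ allVecs (allFin b) (suc d) ] ⟦ P? w ⟧)
        ≤ (∑[ w ∈ allVecs (allFin b) (suc d) ] ⟦ cylinderHull? P? w ⟧) + s * τ
    -- The truncated subtraction is exact as soon as some word satisfies the predicate.
    balanced a c P? mono = proj₂ (balanced-colouring b d s τ 1≤s T≤) P? {toℕ c ∸ toℕ (h a)} (≤-<-trans (m∸n≤m (toℕ c) (toℕ (h a))) (toℕ<n c))
      (λ w pw → sym (trans (cong (_∸ toℕ (h a)) (trans (cong toℕ (sym (mono w pw))) (toℕ-colour a w)))
                           (m+n∸n≡m (toℕ (f w)) (toℕ (h a)))))

    sparse : ∀ (y : Point {b} {H} (suc d)) c → ∑[ a ∈ shapes d k ] ⟦ colour a (digits (level a) y) ≟ᶠ c ⟧ ≤ t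
    sparse y c = ^-cancelʳ-≤ Q 2≤Q (begin
      Q ^ (∑[ a ∈ shapes d k ] ⟦ colour a (digits (level a) y) ≟ᶠ c ⟧)
        ≤⟨ ^-monoʳ-≤ Q {{>-nonZero 1≤Q}} (∑-mono (shapes d k) (λ a → ⟦⟧-mono (_ ≟ᶠ c) (yes tt ×-dec R? (y , c) a (h a))
             (λ eq → tt , trans (sym (toℕ-colour a _)) (cong toℕ eq)))) ⟩
      Q ^ n
        ≤⟨ ^-monoˡ-≤ n (n≤1+n Q) ⟩
      suc Q ^ n
        ≤⟨ *-cancelʳ-≤′ ((Q * Q) ^ K) (1≤m^n K (*-mono-≤ 1≤Q 1≤Q)) main ⟩
      2 * length js
        ≡⟨ cong (2 *_) length-js ⟩
      2 * (Q ^ (4 * (H * suc d)) * (Q * Q + Q * Q))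
        ≡⟨ lem₂ (Q ^ (4 * (H * suc d))) (Q * Q) ⟩
      Q ^ (4 * (H * suc d)) * (4 * (Q * Q))
        ≤⟨ *-monoʳ-≤ (Q ^ (4 * (H * suc d))) (*-monoˡ-≤ (Q * Q) (*-mono-≤ 2≤Q 2≤Q)) ⟩
      Q ^ (4 * (H * suc d)) * (Q * Q * (Q * Q))
        ≡⟨ cong (Q ^ (4 * (H * suc d)) *_) (lem₃ Q) ⟩
      Q ^ (4 * (H * suc d)) * Q ^ 4
        ≡⟨ sym (^-distribˡ-+-* Q (4 * (H * suc d)) 4) ⟩
      Q ^ t ∎)
      where
      open ≤-Reasoning
      1≤Q : 1 ≤ Q
      1≤Q = ≤-trans (s≤s z≤n) 2≤Q
      K n : ℕ
      K = k ^ d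
      n = ∑[ a ∈ shapes d k ] ⟦ yes tt ×-dec R? (y , c) a (h a) ⟧
      size≡K : ∑[ a ∈ shapes d k ] 1 ≡ K
      size≡K = trans (sym (length≡∑ (shapes d k))) (trans (length-allVecs (allFin k) d) (cong (_^ d) (length-allFin k)))
      length-js : length js ≡ Q ^ (4 * (H * suc d)) * (Q * Q + Q * Q)
      length-js = trans (length-cartesianProductWith _,_ (points {b} {H} (suc d)) (allFin (r + r))) (cong₂ _*_
        (trans (length-allVecs (allVecs (allFin b) H) (suc d)) (trans (cong (_^ suc d) (trans (length-allVecs (allFin b) H) (cong (_^ H) (length-allFin b))))
          (trans (^-*-assoc (Q ^ 4) H (suc d)) (^-*-assoc Q 4 (H * suc d)))))
        (trans (length-allFin (r + r)) (cong₂ _+_ s+s≡Q² s+s≡Q²)))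
      lem₁ : ∀ Q → Q * Q + Q ≡ Q * suc Q
      lem₁ = solve-∀
      lem₂ : ∀ a q → 2 * (a * (q + q)) ≡ a * (4 * q)
      lem₂ = solve-∀
      lem₃ : ∀ Q → Q * Q * (Q * Q) ≡ Q * (Q * (Q * (Q * 1)))
      lem₃ = solve-∀
      lem₄ : ∀ l a → l * (a * (2 * a)) ≡ 2 * l * (a * a)
      lem₄ = solve-∀
      main : suc Q ^ n * (Q * Q) ^ K ≤ 2 * length js * (Q * Q) ^ K
      main = begin
        suc Q ^ n * (Q * Q) ^ K              ≡⟨ *-comm (suc Q ^ n) _ ⟩
        (Q * Q) ^ K * suc Q ^ n              ≡⟨ cong (λ m → m * suc Q ^ n) (cong₂ _^_ (sym s+s≡Q²) (sym size≡K)) ⟩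
        r ^ (∑[ a ∈ shapes d k ] 1) * suc Q ^ n ≤⟨ proj₂ shift (∈-cartesianProduct⁺ (∈-allVecs (∈-allVecs ∈-allFin) y) (∈-allFin c)) ⟩
        length js * (r + Q) ^ (∑[ a ∈ shapes d k ] 1) ≡⟨ cong (length js *_) (cong₂ _^_ (trans (cong (_+ Q) s+s≡Q²) (lem₁ Q)) size≡K) ⟩
        length js * (Q * suc Q) ^ K          ≡⟨ cong (length js *_) (^-distribʳ-* K Q (suc Q)) ⟩
        length js * (Q ^ K * suc Q ^ K)      ≤⟨ *-monoʳ-≤ (length js) (*-monoʳ-≤ (Q ^ K) ([1+m]^j≤2m^j K 1≤Q 2K≤Q)) ⟩
        length js * (Q ^ K * (2 * Q ^ K))    ≡⟨ lem₄ (length js) (Q ^ K) ⟩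
        2 * length js * (Q ^ K * Q ^ K)      ≡⟨ cong (2 * length js *_) (sym (^-distribʳ-* K Q Q)) ⟩
        2 * length js * (Q * Q) ^ K          ∎

allPairs-lookup : ∀ {A : Set} {R : A → A → Set} → (∀ {x y} → R x y → R y x) →
  ∀ {xs x y} → AllPairs R xs → x ∈ˡ xs → y ∈ˡ xs → x ≢ y → R x y
allPairs-lookup sy (p ∷ ps) (here refl) (here refl) x≢y = ⊥-elim (x≢y refl)
allPairs-lookup sy (p ∷ ps) (here refl) (there y∈)  x≢y = All.lookup p y∈
allPairs-lookup sy (p ∷ ps) (there x∈)  (here refl) x≢y = sy (All.lookup p x∈)
allPairs-lookup sy (p ∷ ps) (there x∈)  (there y∈)  x≢y = allPairs-lookup sy ps x∈ y∈ x≢y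

minimum : ∀ {A : Set} (g : A → ℕ) x (xs : List A) → ∃ λ m → m ∈ˡ (x ∷ xs) × (∀ {y} → y ∈ˡ (x ∷ xs) → g m ≤ g y)
minimum g x []       = x , here refl , λ { (here refl) → ≤-refl }
minimum g x (z ∷ xs) with m , m∈ , hm ← minimum g z xs | ≤-total (g x) (g m)
... | inj₁ x≤m = x , here refl , λ { (here refl) → ≤-refl ; (there y∈) → ≤-trans x≤m (hm y∈) }
... | inj₂ m≤x = m , there m∈ , λ { (here refl) → m≤x ; (there y∈) → hm y∈ }

-- The graph on slots: independent sets, then cliques.

module Slots {d k b r ν : ℕ} (colour : Shape d k → Vec (Fin b) (suc d) → Fin r) where

  private
    H : ℕ
    H = suc (d * k)
    P : List (Point {b} {H} (suc d))
    P = points (suc d)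

  -- A key is a copy of the construction together with a colour; different keys are never adjacent.
  -- A slot names a tile by one of its points, so each box is listed once for each of its
  -- `b ^ (d * k)` points.
  Key Slot : Set
  Key  = Fin ν × Fin r
  Slot = Fin ν × (Shape d k × Point {b} {H} (suc d))

  keys : List Key
  keys = cartesianProduct (allFin ν) (allFin r)

  slots : List Slot
  slots = cartesianProduct (allFin ν) (cartesianProduct (shapes d k) P)

  shape : Slot → Shape d k
  shape (_ , a , _) = a

  point : Slot → Point {b} {H} (suc d)
  point (_ , _ , x) = x

  key : Slot → Key
  key (κ , a , x) = κ , colour a (digits (level a) x)

  Agree : Slot → Slot → Set
  Agree σ σ′ = ∀ i (p : Fin H) → height (shape σ) i ≤ toℕ p → height (shape σ′) i ≤ toℕ p →
               lookup (lookup (point σ) i) p ≡ lookup (lookup (point σ′) i) p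

  Adj : Slot → Slot → Set
  Adj σ σ′ = key σ ≡ key σ′ × Agree σ σ′

  Adj-sym : ∀ {σ σ′} → Adj σ σ′ → Adj σ′ σ
  Adj-sym (eq , agree) = sym eq , λ i p h h′ → sym (agree i p h′ h)

  Adj-refl : ∀ {σ} → Adj σ σ
  Adj-refl = refl , λ _ _ _ _ → refl

  _≟ᵏ_ : DecidableEquality Key
  _≟ᵏ_ = Product.≡-dec _≟ᶠ_ _≟ᶠ_

  _≟ˢ_ : DecidableEquality (Shape d k)
  _≟ˢ_ = Vec.≡-dec _≟ᶠ_

  digits-tile : ∀ (a : Shape d k) (x y : Point {b} {H} (suc d)) → InTile (height a) x y → digits (level a) y ≡ digits (level a) x
  digits-tile a x y h = digits-cong (level a) y x (λ i → h i (level a i) (≤-reflexive (sym (toℕ-level a i))))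


  module Independent {T : List Slot} (independent : AllPairs (λ σ σ′ → ¬ Adj σ σ′) T) where

    Covers : Key → Shape d k → Point (suc d) → Slot → Set
    Covers o a y σ = key σ ≡ o × shape σ ≡ a × InTile (height (shape σ)) (point σ) y

    covers? : ∀ o a y σ → Dec (Covers o a y σ)
    covers? o a y σ = (key σ ≟ᵏ o) ×-dec ((shape σ ≟ˢ a) ×-dec inTile? (height (shape σ)) (point σ) y)

    cover : Key → Shape d k → Point (suc d) → ℕ
    cover o a y = ∑[ σ ∈ T ] ⟦ covers? o a y σ ⟧

    -- Two slots of the same key and shape whose tiles share a point would be adjacent. As `Adj` is
    -- reflexive, this also excludes repeated slots. So `cover o a` is the indicator of the set Y_a.
    cover-≤1 : ∀ o a y → cover o a y ≤ 1
    cover-≤1 o a y = ∑-⟦⟧-≤1 (covers? o a y) (AllPairs.map adj independent)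
      where
      adj : ∀ {σ σ′} → ¬ Adj σ σ′ → ¬ (Covers o a y σ × Covers o a y σ′)
      adj ¬adj ((eq , _ , h) , (eq′ , _ , h′)) =
        ¬adj (trans eq (sym eq′) , λ i p q q′ → trans (sym (h i p q)) (h′ i p q′))

    -- The set Z_a: on every fibre of the digits at `level a` it is the cylinder hull of Y_a.
    Near : Key → Shape d k → Point (suc d) → Set
    Near o a y = CylinderHull (λ w → 1 ≤ cover o a (setDigits (level a) w y)) (digits (level a) y)

    near? : ∀ o a y → Dec (Near o a y)
    near? o a y = cylinderHull? (λ w → 1 ≤? cover o a (setDigits (level a) w y)) (digits (level a) y)

    cover-witness : ∀ o a y → 1 ≤ cover o a y → ∃ λ σ → σ ∈ˡ T × Covers o a y σ
    cover-witness o a y 1≤ =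
      let σ , σ∈ , c = ∑-pos T (λ σ → ⟦ covers? o a y σ ⟧) 1≤ in σ , σ∈ , ⟦⟧-pos (covers? o a y σ) c

    Witness : Key → Shape d k → Point (suc d) → Fin (suc d) → Slot → Set
    Witness o a y i σ = σ ∈ˡ T × key σ ≡ o × shape σ ≡ a ×
      (∀ l (p : Fin H) → height (shape σ) l ≤ toℕ p → (l ≡ i → toℕ p ≢ height a i) →
        lookup (lookup (point σ) l) p ≡ lookup (lookup y l) p)

    near-witness : ∀ o a y → Near o a y → ∀ i → ∃ (Witness o a y i)
    near-witness o a y near i = unpack (cover-witness o a (setDigits (level a) w y) (proj₂ (near i)))
      where
      w : Vec (Fin b) (suc d)
      w = digits (level a) y [ i ]≔ proj₁ (near i)
      unpack : (∃ λ σ → σ ∈ˡ T × Covers o a (setDigits (level a) w y) σ) → ∃ (Witness o a y i)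
      unpack (σ , σ∈ , eq , eq′ , h) = σ , σ∈ , eq , eq′ , λ l p q p≢ → trans (sym (h l p q))
        (setDigits-perturb (level a) y i (proj₁ (near i)) l p
          (λ l≡i p≡ → p≢ l≡i (trans (cong toℕ p≡) (toℕ-level a i))))

    -- A tile of a whose digit at height (height a i) is altered still reaches into every box that is
    -- longer in direction i.  Since the heights form an antichain, two distinct shapes near the same
    -- point are each altered in a direction in which they are the shorter one.
    near-disjoint : ∀ o y {a a′} → a ≢ a′ → ¬ (Near o a y × Near o a′ y)
    near-disjoint o y {a} {a′} a≢a′ (near , near′) =
      let i , hi = height-antichain a a′ a≢a′
          j , hj = height-antichain a′ a (a≢a′ ∘ sym)
      in conflict hi hj (near-witness o a y near i) (near-witness o a′ y near′ j)
      where
      conflict : ∀ {i j} → height a i < height a′ i → height a′ j < height a j →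
        ∃ (Witness o a y i) → ∃ (Witness o a′ y j) → ⊥
      conflict hi hj (σ , σ∈ , eq , refl , h) (σ′ , σ′∈ , eq′ , refl , h′) =
        allPairs-lookup (λ {σ} {σ′} ¬p q → ¬p (Adj-sym {σ′} {σ} q)) independent σ∈ σ′∈ (λ { refl → a≢a′ refl })
          (trans eq (sym eq′) , λ l p q q′ → trans
            (h l p q (λ { refl p≡ → <⇒≱ hi (≤-trans q′ (≤-reflexive p≡)) }))
            (sym (h′ l p q′ (λ { refl p≡ → <⇒≱ hj (≤-trans q (≤-reflexive p≡)) }))))

    ∑-near-≤1 : ∀ o y → ∑[ a ∈ shapes d k ] ⟦ near? o a y ⟧ ≤ 1
    ∑-near-≤1 o y = ∑-⟦⟧-≤1 (λ a → near? o a y)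
      (AllPairs.map (near-disjoint o y) (unique-allVecs (Unique.allFin⁺ k) d))

    -- Double counting: every slot covers the `b ^ (d * k)` points of its tile under its own key and
    -- shape.
    tiles-≤-cover : length T * b ^ (d * k) ≤ ∑[ o ∈ keys ] ∑[ a ∈ shapes d k ] ∑[ y ∈ P ] cover o a y
    tiles-≤-cover = begin
      length T * b ^ (d * k)
        ≡⟨ sym (∑-const T _) ⟩
      ∑[ σ ∈ T ] (b ^ (d * k))
        ≤⟨ ∑-mono T tile ⟩
      ∑[ σ ∈ T ] ∑[ o ∈ keys ] ∑[ a ∈ shapes d k ] ∑[ y ∈ P ] ⟦ covers? o a y σ ⟧
        ≡⟨ ∑-swap T keys _ ⟩
      ∑[ o ∈ keys ] ∑[ σ ∈ T ] ∑[ a ∈ shapes d k ] ∑[ y ∈ P ] ⟦ covers? o a y σ ⟧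
        ≡⟨ ∑-cong keys (λ o → trans (∑-swap T (shapes d k) _) (∑-cong (shapes d k) (λ a → ∑-swap T P _))) ⟩
      ∑[ o ∈ keys ] ∑[ a ∈ shapes d k ] ∑[ y ∈ P ] cover o a y ∎
      where
      open ≤-Reasoning
      tile : ∀ σ → b ^ (d * k) ≤ ∑[ o ∈ keys ] ∑[ a ∈ shapes d k ] ∑[ y ∈ P ] ⟦ covers? o a y σ ⟧
      tile σ = begin
        b ^ (d * k)
          ≡⟨ sym (∏-height b (shape σ)) ⟩
        ∏ (λ i → b ^ height (shape σ) i)
          ≡⟨ sym (tile-size (height (shape σ)) (λ i → ≤-trans (height-≤ (shape σ) i) (n≤1+n _)) (point σ)) ⟩
        ∑[ y ∈ P ] ⟦ inTile? (height (shape σ)) (point σ) y ⟧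
          ≤⟨ ∑-mono P (λ y → ⟦⟧-mono (inTile? (height (shape σ)) (point σ) y) (covers? (key σ) (shape σ) y σ)
               (λ h → refl , refl , h)) ⟩
        ∑[ y ∈ P ] ⟦ covers? (key σ) (shape σ) y σ ⟧
          ≤⟨ ≤-∑ (λ a → ∑[ y ∈ P ] ⟦ covers? (key σ) a y σ ⟧) (∈-allVecs ∈-allFin (shape σ)) ⟩
        ∑[ a ∈ shapes d k ] ∑[ y ∈ P ] ⟦ covers? (key σ) a y σ ⟧
          ≤⟨ ≤-∑ (λ o → ∑[ a ∈ shapes d k ] ∑[ y ∈ P ] ⟦ covers? o a y σ ⟧)
               (∈-cartesianProduct⁺ (∈-allFin (proj₁ σ)) (∈-allFin (proj₂ (key σ)))) ⟩
        ∑[ o ∈ keys ] ∑[ a ∈ shapes d k ] ∑[ y ∈ P ] ⟦ covers? o a y σ ⟧ ∎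

    module _ {s τ : ℕ} (1≤b : 1 ≤ b) (Ksτ≤ : k ^ d * (s * τ) ≤ b ^ suc d)
      (balanced : ∀ a c {P : Vec (Fin b) (suc d) → Set} (P? : ∀ w → Dec (P w)) → (∀ w → P w → colour a w ≡ c) →
        s * (∑[ w ∈ allVecs (allFin b) (suc d) ] ⟦ P? w ⟧)
        ≤ (∑[ w ∈ allVecs (allFin b) (suc d) ] ⟦ cylinderHull? P? w ⟧) + s * τ) where

      private
        W : List (Vec (Fin b) (suc d))
        W = allVecs (allFin b) (suc d)

      -- `balanced` applies to the trace of Y_a on the fibre through `y`. Its words all have the
      -- colour of the key `o`, because a covering tile prescribes the digits at `level a`, and its
      -- cylinder hull consists of points of `Near`.
      fibre-bound : ∀ o a y →
        s * (∑[ w ∈ W ] cover o a (setDigits (level a) w y))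
        ≤ (∑[ w ∈ W ] ⟦ near? o a (setDigits (level a) w y) ⟧) + s * τ
      fibre-bound o a y = begin
        s * (∑[ w ∈ W ] cover o a (setDigits (level a) w y))
          ≤⟨ *-monoʳ-≤ s (∑-mono W indicator) ⟩
        s * (∑[ w ∈ W ] ⟦ covered? w ⟧)
          ≤⟨ balanced a (proj₂ o) covered? monochromatic ⟩
        (∑[ w ∈ W ] ⟦ cylinderHull? covered? w ⟧) + s * τ
          ≤⟨ +-monoˡ-≤ (s * τ) (∑-mono W (λ w → ⟦⟧-mono (cylinderHull? covered? w) (near? o a (setDigits (level a) w y)) (hull⇒near w))) ⟩
        (∑[ w ∈ W ] ⟦ near? o a (setDigits (level a) w y) ⟧) + s * τ ∎
        where
        open ≤-Reasoning
        covered? : ∀ w → Dec (1 ≤ cover o a (setDigits (level a) w y))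
        covered? w = 1 ≤? cover o a (setDigits (level a) w y)
        indicator : ∀ w → cover o a (setDigits (level a) w y) ≤ ⟦ covered? w ⟧
        indicator w with covered? w
        ... | yes _ = cover-≤1 o a (setDigits (level a) w y)
        ... | no ¬p = ≤-reflexive (n<1⇒n≡0 (≰⇒> ¬p))
        monochromatic : ∀ w → 1 ≤ cover o a (setDigits (level a) w y) → colour a w ≡ proj₂ o
        monochromatic w 1≤ = unpack (cover-witness o a (setDigits (level a) w y) 1≤)
          where
          unpack : (∃ λ σ → σ ∈ˡ T × Covers o a (setDigits (level a) w y) σ) → colour a w ≡ proj₂ o
          unpack (σ , _ , eq , refl , h) = trans
            (cong (colour a) (trans (sym (digits-setDigits (level a) w y)) (digits-tile a (point σ) _ h))) (cong proj₂ eq)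
        hull⇒near : ∀ w → CylinderHull (λ w → 1 ≤ cover o a (setDigits (level a) w y)) w → Near o a (setDigits (level a) w y)
        hull⇒near w h i = proj₁ (h i) , subst (1 ≤_) (cong (cover o a) (eq (proj₁ (h i)))) (proj₂ (h i))
          where
          eq : ∀ s → setDigits (level a) (w [ i ]≔ s) y ≡
               setDigits (level a) (digits (level a) (setDigits (level a) w y) [ i ]≔ s) (setDigits (level a) w y)
          eq s = trans (sym (setDigits-setDigits (level a) w _ y))
                 (cong (λ v → setDigits (level a) (v [ i ]≔ s) (setDigits (level a) w y)) (sym (digits-setDigits (level a) w y)))

      -- `fibre-bound` is summed over all `y`; by `∑-setDigits` every point is then counted
      -- `b ^ suc d` times.
      shape-bound : ∀ o a → b ^ suc d * (s * (∑[ y ∈ P ] cover o a y))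
                    ≤ b ^ suc d * (∑[ y ∈ P ] ⟦ near? o a y ⟧) + length P * (s * τ)
      shape-bound o a = begin
        b ^ suc d * (s * ∑ P (cover o a))
          ≡⟨ lem (b ^ suc d) s _ ⟩
        s * (b ^ suc d * ∑ P (cover o a))
          ≡⟨ cong (s *_) (sym (∑-setDigits (level a) (cover o a))) ⟩
        s * (∑[ y ∈ P ] ∑[ w ∈ W ] cover o a (setDigits (level a) w y))
          ≡⟨ sym (∑-* P s _) ⟩
        ∑[ y ∈ P ] (s * (∑[ w ∈ W ] cover o a (setDigits (level a) w y)))
          ≤⟨ ∑-mono P (fibre-bound o a) ⟩
        ∑[ y ∈ P ] ((∑[ w ∈ W ] ⟦ near? o a (setDigits (level a) w y) ⟧) + s * τ)
          ≡⟨ ∑-+ P _ _ ⟩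
        (∑[ y ∈ P ] ∑[ w ∈ W ] ⟦ near? o a (setDigits (level a) w y) ⟧) + (∑[ y ∈ P ] (s * τ))
          ≡⟨ cong₂ _+_ (∑-setDigits (level a) (λ y → ⟦ near? o a y ⟧)) (∑-const P (s * τ)) ⟩
        b ^ suc d * (∑[ y ∈ P ] ⟦ near? o a y ⟧) + length P * (s * τ) ∎
        where
        open ≤-Reasoning
        lem : ∀ a b c → a * (b * c) ≡ b * (a * c)
        lem = solve-∀

      -- The factor 2 has two sources: the sets `Near` of different shapes are disjoint and fill the
      -- cube at most once, and by `Ksτ≤` the errors of all `k ^ d` shapes together amount to at
      -- most one more cube.
      key-bound : ∀ o → s * (∑[ a ∈ shapes d k ] ∑[ y ∈ P ] cover o a y) ≤ 2 * length P
      key-bound o = *-cancelʳ-≤′ (b ^ suc d) (1≤m^n (suc d) 1≤b) (begin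
        s * X * b ^ suc d
          ≡⟨ *-comm (s * X) _ ⟩
        b ^ suc d * (s * X)
          ≡⟨ trans (cong (b ^ suc d *_) (sym (∑-* A s _))) (sym (∑-* A (b ^ suc d) _)) ⟩
        ∑[ a ∈ A ] (b ^ suc d * (s * (∑[ y ∈ P ] cover o a y)))
          ≤⟨ ∑-mono A (shape-bound o) ⟩
        ∑[ a ∈ A ] (b ^ suc d * (∑[ y ∈ P ] ⟦ near? o a y ⟧) + length P * (s * τ))
          ≡⟨ trans (∑-+ A _ _) (cong₂ _+_ (trans (∑-* A (b ^ suc d) _) (cong (b ^ suc d *_) (∑-swap A P _))) (∑-const A _)) ⟩
        b ^ suc d * (∑[ y ∈ P ] ∑[ a ∈ A ] ⟦ near? o a y ⟧) + length A * (length P * (s * τ))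
          ≤⟨ +-mono-≤ (*-monoʳ-≤ (b ^ suc d) (∑-mono P (∑-near-≤1 o))) (≤-reflexive (lem₁ (length A) (length P) (s * τ))) ⟩
        b ^ suc d * (∑[ y ∈ P ] 1) + length P * (length A * (s * τ))
          ≤⟨ +-mono-≤ (≤-reflexive (cong (b ^ suc d *_) (sym (length≡∑ P))))
               (*-monoʳ-≤ (length P) (≤-trans (≤-reflexive (cong (_* (s * τ)) length-A)) Ksτ≤)) ⟩
        b ^ suc d * length P + length P * b ^ suc d
          ≡⟨ lem₂ (b ^ suc d) (length P) ⟩
        2 * length P * b ^ suc d ∎)
        where
        open ≤-Reasoning
        A : List (Shape d k)
        A = shapes d k
        X : ℕ
        X = ∑[ a ∈ A ] ∑[ y ∈ P ] cover o a y
        length-A : length A ≡ k ^ d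
        length-A = trans (length-allVecs (allFin k) d) (cong (_^ d) (length-allFin k))
        lem₁ : ∀ a p x → a * (p * x) ≡ p * (a * x)
        lem₁ = solve-∀
        lem₂ : ∀ w p → w * p + p * w ≡ 2 * p * w
        lem₂ = solve-∀

      independent-bound : s * (length T * b ^ (d * k)) ≤ ν * r * (2 * length P)
      independent-bound = begin
        s * (length T * b ^ (d * k))
          ≤⟨ *-monoʳ-≤ s tiles-≤-cover ⟩
        s * (∑[ o ∈ keys ] ∑[ a ∈ shapes d k ] ∑[ y ∈ P ] cover o a y)
          ≡⟨ sym (∑-* keys s _) ⟩
        ∑[ o ∈ keys ] (s * (∑[ a ∈ shapes d k ] ∑[ y ∈ P ] cover o a y))
          ≤⟨ ∑-mono keys key-bound ⟩
        ∑[ o ∈ keys ] (2 * length P)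
          ≡⟨ trans (∑-const keys _) (cong (_* (2 * length P))
               (trans (length-cartesianProductWith _,_ (allFin ν) (allFin r)) (cong₂ _*_ (length-allFin ν) (length-allFin r)))) ⟩
        ν * r * (2 * length P) ∎
        where open ≤-Reasoning

  -- A clique has a common point `y`, at which its colour occurs for at most `t` shapes; each of
  -- these tiles is listed `b ^ (d * k)` times in one copy. The inequality for all `g` expresses
  -- that `T` is contained in `μ` copies of `slots`.
  clique-bound : ∀ {t μ} {T : List Slot} → AllPairs Adj T → (∀ g → ∑ T g ≤ μ * ∑ slots g) →
    (∀ y c → ∑[ a ∈ shapes d k ] ⟦ colour a (digits (level a) y) ≟ᶠ c ⟧ ≤ t) →
    length T ≤ μ * (t * b ^ (d * k))
  clique-bound {T = []} _ _ _ = z≤n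
  clique-bound {t} {μ} {T = T@(σ₀ ∷ T′)} clique within sparse = begin
    length T
      ≡⟨ length≡∑ T ⟩
    ∑[ σ ∈ T ] 1
      ≤⟨ ∑-mono-∈ T (λ {σ} σ∈ → ≤-reflexive (sym (weight≡1 σ σ∈))) ⟩
    ∑ T weight
      ≤⟨ within weight ⟩
    μ * ∑ slots weight
      ≤⟨ *-monoʳ-≤ μ total-weight ⟩
    μ * (t * b ^ (d * k)) ∎
    where
    open ≤-Reasoning
    κ₀ : Fin ν
    κ₀ = proj₁ σ₀
    c₀ : Fin r
    c₀ = proj₂ (key σ₀)
    adj : ∀ {σ σ′} → σ ∈ˡ T → σ′ ∈ˡ T → Adj σ σ′
    adj {σ} {σ′} σ∈ σ′∈ with Product.≡-dec _≟ᶠ_ (Product.≡-dec _≟ˢ_ (Vec.≡-dec (Vec.≡-dec _≟ᶠ_))) σ σ′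
    ... | yes refl = Adj-refl {σ}
    ... | no σ≢σ′  = allPairs-lookup (λ {σ} {σ′} → Adj-sym {σ} {σ′}) clique σ∈ σ′∈ σ≢σ′
    -- The member with the least exponent in direction `i` prescribes the most digits there, so its
    -- coordinate `i` fits into every tile of the clique.
    finest : ∀ i → ∃ λ m → m ∈ˡ T × (∀ {σ} → σ ∈ˡ T → height (shape m) i ≤ height (shape σ) i)
    finest i = minimum (λ σ → height (shape σ) i) σ₀ T′
    coordinate : Fin (suc d) → Vec (Fin b) H
    coordinate i = lookup (point (proj₁ (finest i))) i
    y : Point {b} {H} (suc d)
    y = Vec.tabulate coordinate
    y∈tile : ∀ {σ} → σ ∈ˡ T → InTile (height (shape σ)) (point σ) y
    y∈tile {σ} σ∈ i p h = trans (cong (λ x → lookup x p) (Vec.lookup∘tabulate coordinate i))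
      (proj₂ (adj {proj₁ (finest i)} {σ} (proj₁ (proj₂ (finest i))) σ∈) i p (≤-trans (proj₂ (proj₂ (finest i)) σ∈) h) h)
    -- The indicator of the slots in the copy and colour of the clique whose tile contains `y`; it
    -- is 1 on `T`.
    weight : Slot → ℕ
    weight (κ , a , x) = ⟦ κ ≟ᶠ κ₀ ⟧ * (⟦ colour a (digits (level a) y) ≟ᶠ c₀ ⟧ * ⟦ inTile? (height a) y x ⟧)
    weight≡1 : ∀ σ → σ ∈ˡ T → weight σ ≡ 1
    weight≡1 σ@(κ , a , x) σ∈ = cong₂ _*_ (⟦⟧-yes (κ ≟ᶠ κ₀) (cong proj₁ key≡)) (cong₂ _*_
      (⟦⟧-yes (colour a (digits (level a) y) ≟ᶠ c₀)
        (trans (cong (colour a) (digits-tile a x y (y∈tile σ∈))) (cong proj₂ key≡)))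
      (⟦⟧-yes (inTile? (height a) y x) (λ i p h → sym (y∈tile σ∈ i p h))))
      where
      key≡ : key σ ≡ key σ₀
      key≡ = proj₁ (adj σ∈ (here refl))
    total-weight : ∑ slots weight ≤ t * b ^ (d * k)
    total-weight = begin
      ∑ slots weight
        ≡⟨ trans (∑-cartesianProductWith _,_ (allFin ν) _ weight)
                 (∑-cong (allFin ν) (λ κ → ∑-cartesianProductWith _,_ (shapes d k) P (λ ax → weight (κ , ax)))) ⟩
      ∑[ κ ∈ allFin ν ] ∑[ a ∈ shapes d k ] ∑[ x ∈ P ] weight (κ , a , x)
        ≡⟨ ∑-cong (allFin ν) (λ κ → trans (∑-cong (shapes d k) (λ a → trans (∑-* P ⟦ κ ≟ᶠ κ₀ ⟧ _)
             (cong (⟦ κ ≟ᶠ κ₀ ⟧ *_) (trans (∑-* P ⟦ colour a (digits (level a) y) ≟ᶠ c₀ ⟧ _)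
               (cong (⟦ colour a (digits (level a) y) ≟ᶠ c₀ ⟧ *_) (tile a))))))
             (trans (∑-* (shapes d k) ⟦ κ ≟ᶠ κ₀ ⟧ _) (cong (⟦ κ ≟ᶠ κ₀ ⟧ *_) (∑-*ʳ (shapes d k) (b ^ (d * k)) _)))) ⟩
      ∑[ κ ∈ allFin ν ] (⟦ κ ≟ᶠ κ₀ ⟧ * ((∑[ a ∈ shapes d k ] ⟦ colour a (digits (level a) y) ≟ᶠ c₀ ⟧) * b ^ (d * k)))
        ≡⟨ ∑-*ʳ (allFin ν) _ _ ⟩
      (∑[ κ ∈ allFin ν ] ⟦ κ ≟ᶠ κ₀ ⟧) * ((∑[ a ∈ shapes d k ] ⟦ colour a (digits (level a) y) ≟ᶠ c₀ ⟧) * b ^ (d * k))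
        ≤⟨ *-mono-≤ (∑-⟦⟧-unique (_≟ᶠ κ₀) (λ p q → trans p (sym q))) (*-monoˡ-≤ (b ^ (d * k)) (sparse y c₀)) ⟩
      1 * (t * b ^ (d * k))
        ≡⟨ *-identityˡ _ ⟩
      t * b ^ (d * k) ∎
      where
      tile : ∀ (a : Shape d k) → ∑[ x ∈ P ] ⟦ inTile? (height a) y x ⟧ ≡ b ^ (d * k)
      tile a = trans (tile-size (height a) (λ i → ≤-trans (height-≤ a i) (n≤1+n _)) y) (∏-height b a)

-- Realisation by boxes with integer endpoints.

module _ {b : ℕ} where

  lowDigit highDigit : ℕ → Fin b → ℕ
  lowDigit  zero    x = toℕ x
  lowDigit  (suc _) x = 0
  highDigit zero    x = toℕ x
  highDigit (suc _) x = b ∸ 1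

  -- The least and the greatest integer whose base-b expansion, read from the least significant digit,
  -- agrees with v at all positions ≥ e and continues with the number o.
  left right : ∀ {n} → ℕ → ℕ → Vec (Fin b) n → ℕ
  left  o e []      = o
  left  o e (x ∷ v) = lowDigit e x + b * left o (pred e) v
  right o e []      = o
  right o e (x ∷ v) = highDigit e x + b * right o (pred e) v

  lowDigit≤highDigit : ∀ e e′ x x′ → (e ≤ 0 → e′ ≤ 0 → x ≡ x′) → lowDigit e x ≤ highDigit e′ x′
  lowDigit≤highDigit zero    zero     x x′ eq = ≤-reflexive (cong toℕ (eq z≤n z≤n))
  lowDigit≤highDigit zero    (suc e′) x x′ eq = m+n≤o⇒m≤o∸n (toℕ x) (≤-trans (≤-reflexive (+-comm _ 1)) (toℕ<n x))
  lowDigit≤highDigit (suc e) e′       x x′ eq = z≤n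

  highDigit< : ∀ e (x : Fin b) → highDigit e x < b
  highDigit< zero    x = toℕ<n x
  highDigit< (suc e) x = ∸-monoʳ-< (s≤s z≤n) (≤-trans (s≤s z≤n) (toℕ<n x))

  -- The comparison holds digit by digit: a free digit is 0 on the left and `b - 1` on the right,
  -- and digits prescribed on both sides are equal.
  left≤right : ∀ {n} o e e′ (v v′ : Vec (Fin b) n) →
    (∀ p → e ≤ toℕ p → e′ ≤ toℕ p → lookup v p ≡ lookup v′ p) → left o e v ≤ right o e′ v′
  left≤right o e e′ []      []        agree = ≤-refl
  left≤right o e e′ (x ∷ v) (x′ ∷ v′) agree = +-mono-≤ (lowDigit≤highDigit e e′ x x′ (agree zero))
    (*-monoʳ-≤ b (left≤right o (pred e) (pred e′) v v′ (λ p q q′ → agree (suc p) (suc-pred-≤ q) (suc-pred-≤ q′))))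
    where
    suc-pred-≤ : ∀ {e p} → pred e ≤ p → e ≤ suc p
    suc-pred-≤ {zero}  _ = z≤n
    suc-pred-≤ {suc e} q = s≤s q

  quotient-≤ : ∀ {x y m n} → y < b → x + b * m ≤ y + b * n → m ≤ n
  quotient-≤ {x} {y} {m} {n} y<b h with m ≤? n
  ... | yes m≤n = m≤n
  ... | no  m≰n = ⊥-elim (<⇒≱ (begin-strict
    y + b * n   <⟨ +-monoˡ-< (b * n) y<b ⟩
    b + b * n   ≡⟨ sym (*-suc b n) ⟩
    b * suc n   ≤⟨ *-monoʳ-≤ b (≰⇒> m≰n) ⟩
    b * m       ≤⟨ m≤n+m _ x ⟩
    x + b * m   ∎) h)
    where open ≤-Reasoning

  right-0≡left-0 : ∀ {n} o (v : Vec (Fin b) n) → right o 0 v ≡ left o 0 v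
  right-0≡left-0 o []      = refl
  right-0≡left-0 o (x ∷ v) = cong (λ m → toℕ x + b * m) (right-0≡left-0 o v)

  -- The lowest digit is cancelled by `quotient-≤` in both inequalities until only the offsets
  -- remain.
  overlap⇒offset : ∀ {n} o o′ e e′ (v v′ : Vec (Fin b) n) →
    left o e v ≤ right o′ e′ v′ → left o′ e′ v′ ≤ right o e v → o ≡ o′
  overlap⇒offset o o′ e e′ []      []        h h′ = ≤-antisym h h′
  overlap⇒offset o o′ e e′ (x ∷ v) (x′ ∷ v′) h h′ = overlap⇒offset o o′ (pred e) (pred e′) v v′
    (quotient-≤ (highDigit< e′ x′) h) (quotient-≤ (highDigit< e x) h′)

  -- Lower digits are cancelled in the same way. Once position `p` is the lowest and is prescribed
  -- in both expansions, so are all higher digits; both intervals are then single points and must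
  -- coincide.
  overlap⇒agree : ∀ {n} o o′ e e′ (v v′ : Vec (Fin b) n) →
    left o e v ≤ right o′ e′ v′ → left o′ e′ v′ ≤ right o e v →
    ∀ p → e ≤ toℕ p → e′ ≤ toℕ p → lookup v p ≡ lookup v′ p
  overlap⇒agree o o′ e e′ (x ∷ v) (x′ ∷ v′) h h′ (suc p) q q′ =
    overlap⇒agree o o′ (pred e) (pred e′) v v′
      (quotient-≤ (highDigit< e′ x′) h) (quotient-≤ (highDigit< e x) h′) p (pred-mono-≤ q) (pred-mono-≤ q′)
  overlap⇒agree o o′ zero zero (x ∷ v) (x′ ∷ v′) h h′ zero z≤n z≤n =
    toℕ-injective (≤-antisym
      (+-cancelʳ-≤ (b * l′) _ _ (subst₂ (λ m n → toℕ x + b * m ≤ toℕ x′ + b * n) l≡l′ (right-0≡left-0 o′ v′) h))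
      (+-cancelʳ-≤ (b * l′) _ _ (subst (λ n → toℕ x′ + b * l′ ≤ toℕ x + b * n) (trans (right-0≡left-0 o v) l≡l′) h′)))
    where
    l l′ : ℕ
    l  = left o 0 v
    l′ = left o′ 0 v′
    l≡l′ : l ≡ l′
    l≡l′ = ≤-antisym
      (subst (l ≤_) (right-0≡left-0 o′ v′) (quotient-≤ (toℕ<n x′) h))
      (subst (l′ ≤_) (right-0≡left-0 o v) (quotient-≤ (toℕ<n x) h′))

module _ {d k b r ν : ℕ} (colour : Shape d k → Vec (Fin b) (suc d) → Fin r) where

  open Slots {ν = ν} colour

  -- Boxes of different keys are moved apart along the zeroth axis alone: the encoded key continues
  -- the expansion above its most significant digit.
  offset : Slot → Fin (suc d) → ℕ
  offset σ zero    = toℕ (combine (proj₁ (key σ)) (proj₂ (key σ)))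
  offset σ (suc _) = 0

  private
    extent : Slot → Fin (suc d) → ℕ
    extent σ = height (shape σ)
    coordinate : Slot → Fin (suc d) → Vec (Fin b) (suc (d * k))
    coordinate σ = lookup (point σ)

  box : Slot → Box (suc d)
  box σ i = ℤ.+ left  (offset σ i) (extent σ i) (coordinate σ i)
          , ℤ.+ right (offset σ i) (extent σ i) (coordinate σ i)

  box-isBox : ∀ σ → IsBox (box σ)
  box-isBox σ i =
    ℤ.+≤+ (left≤right (offset σ i) (extent σ i) (extent σ i) (coordinate σ i) (coordinate σ i) (λ _ _ _ → refl))

  adj⇒intersect : ∀ σ σ′ → Adj σ σ′ → Intersect (box σ) (box σ′)
  adj⇒intersect σ σ′ (eq , agree) i = ℤ.+≤+ (half σ σ′ eq (agree i))
    , ℤ.+≤+ (half σ′ σ (sym eq) (λ p q q′ → sym (agree i p q′ q)))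
    where
    offset-≡ : ∀ σ σ′ i → key σ ≡ key σ′ → offset σ i ≡ offset σ′ i
    offset-≡ σ σ′ zero    eq = cong (λ (κ , c) → toℕ (combine κ c)) eq
    offset-≡ σ σ′ (suc _) eq = refl
    half : ∀ σ σ′ → key σ ≡ key σ′ →
      (∀ p → extent σ i ≤ toℕ p → extent σ′ i ≤ toℕ p → lookup (coordinate σ i) p ≡ lookup (coordinate σ′ i) p) →
      left (offset σ i) (extent σ i) (coordinate σ i) ≤ right (offset σ′ i) (extent σ′ i) (coordinate σ′ i)
    half σ σ′ eq h =
      subst (λ o → left (offset σ i) (extent σ i) (coordinate σ i) ≤ right o (extent σ′ i) (coordinate σ′ i))
        (offset-≡ σ σ′ i eq) (left≤right (offset σ i) (extent σ i) (extent σ′ i) (coordinate σ i) (coordinate σ′ i) h)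

  intersect⇒adj : ∀ σ σ′ → Intersect (box σ) (box σ′) → Adj σ σ′
  intersect⇒adj σ σ′ meet = key-≡ , λ i →
    overlap⇒agree (offset σ i) (offset σ′ i) (extent σ i) (extent σ′ i) (coordinate σ i) (coordinate σ′ i)
      (ℤ.drop‿+≤+ (proj₁ (meet i))) (ℤ.drop‿+≤+ (proj₂ (meet i)))
    where
    offset-≡ : offset σ zero ≡ offset σ′ zero
    offset-≡ =
      overlap⇒offset (offset σ zero) (offset σ′ zero) (extent σ zero) (extent σ′ zero) (coordinate σ zero) (coordinate σ′ zero)
        (ℤ.drop‿+≤+ (proj₁ (meet zero))) (ℤ.drop‿+≤+ (proj₂ (meet zero)))
    key-≡ : key σ ≡ key σ′
    key-≡ =
      let p , q = combine-injective (proj₁ (key σ)) (proj₂ (key σ)) (proj₁ (key σ′)) (proj₂ (key σ′))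
                    (toℕ-injective offset-≡)
      in cong₂ _,_ p q

-- From lists of slots to indexed families and their subsets.

pick : ∀ {A : Set} (L : List A) {n} → n ≤ length L → Fin n → A
pick (x ∷ L) (s≤s n≤) zero    = x
pick (x ∷ L) (s≤s n≤) (suc i) = pick L n≤ i

-- The inequality between sums for every `g` expresses that `T` is a sub-multiset of `L`. The last
-- component serves the induction, where the head must be related to every entry of the tail.
select : ∀ {A : Set} {R : A → A → Set} (L : List A) {n} (n≤ : n ≤ length L) (S : Subset n) →
  (∀ i j → i ∈ S → j ∈ S → i ≢ j → R (pick L n≤ i) (pick L n≤ j)) →
  ∃ λ T → length T ≡ ∣ S ∣ × AllPairs R T × (∀ g → ∑ T g ≤ ∑ L g) ×
    (∀ {Q : A → Set} → (∀ i → i ∈ S → Q (pick L n≤ i)) → All Q T)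
select L       z≤n       []            rel = [] , refl , [] , (λ _ → z≤n) , λ _ → []
select (x ∷ L) (s≤s n≤) (outside ∷ S) rel =
  let T , len , pairs , sub , all = select L n≤ S (λ i j i∈ j∈ i≢j →
                                      rel (suc i) (suc j) (there i∈) (there j∈) (i≢j ∘ Fin.suc-injective))
  in T , len , pairs , (λ g → ≤-trans (sub g) (m≤n+m _ (g x))) , λ q → all (λ i i∈ → q (suc i) (there i∈))
select (x ∷ L) (s≤s n≤) (inside ∷ S) rel =
  let T , len , pairs , sub , all = select L n≤ S (λ i j i∈ j∈ i≢j →
                                      rel (suc i) (suc j) (there i∈) (there j∈) (i≢j ∘ Fin.suc-injective))
  in x ∷ T , cong suc len , all (λ i i∈ → rel zero (suc i) here (there i∈) (λ ())) ∷ pairs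
   , (λ g → +-monoʳ-≤ (g x) (sub g)) , λ q → q zero here ∷ all (λ i i∈ → q (suc i) (there i∈))

copies : ∀ {A : Set} → ℕ → List A → List A
copies zero    L = []
copies (suc m) L = L ++ copies m L

∑-copies : ∀ {A : Set} m (L : List A) g → ∑ (copies m L) g ≡ m * ∑ L g
∑-copies zero    L g = refl
∑-copies (suc m) L g = trans (∑-++ L (copies m L) g) (cong (∑ L g +_) (∑-copies m L g))

-- The family of boxes, and the balance of its two bounds.

module _ (d k Q s τ ν μ : ℕ) (s+s≡Q² : s + s ≡ Q * Q) (2≤Q : 2 ≤ Q) (2K≤Q : k ^ d + k ^ d ≤ Q)
  (T≤ : ((s + s) + (s + s)) * (2 ^ ((Q ^ 4) ^ d)) ^ suc d ≤ 2 ^ τ)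
  (Ksτ≤ : k ^ d * (s * τ) ≤ (Q ^ 4) ^ suc d) where

  private
    b E P t : ℕ
    b = Q ^ 4
    E = d * k
    P = (b ^ suc (d * k)) ^ suc d
    t = 4 * (suc (d * k) * suc d) + 4

  -- The first `n` entries of `μ` copies of the list of slots are taken. For independent sets the
  -- `4 * s` colours cancel against the density bound `2 / s`, which leaves the factor 8.
  boxes : ∀ {n} → n ≤ μ * (ν * (k ^ d * P)) →
    ∃ λ (F : Fin n → Box (suc d)) → (∀ i → IsBox (F i)) ×
      (∀ S → IsClique F S → ∣ S ∣ ≤ μ * (t * b ^ E)) ×
      (∀ S → IsIndependent F S → ∣ S ∣ * b ^ E ≤ 8 * (ν * P))
  boxes {n} n≤ = F , (λ i → box-isBox {ν = ν} colour (pick L′ n≤L′ i)) , clique , independent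
    where
    colour : Shape d k → Vec (Fin b) (suc d) → Fin ((s + s) + (s + s))
    colour = proj₁ (colouring d k Q s τ s+s≡Q² 2≤Q 2K≤Q T≤)
    open Slots {ν = ν} colour
    L′ : List Slot
    L′ = copies μ slots
    length-points : length (points {b} {suc (d * k)} (suc d)) ≡ P
    length-points = trans (length-allVecs (allVecs (allFin b) (suc (d * k))) (suc d))
      (cong (_^ suc d) (trans (length-allVecs (allFin b) (suc (d * k))) (cong (_^ suc (d * k)) (length-allFin b))))
    length-L′ : length L′ ≡ μ * (ν * (k ^ d * P))
    length-L′ = begin
      length L′                       ≡⟨ length≡∑ L′ ⟩
      ∑[ _ ∈ L′ ] 1                   ≡⟨ ∑-copies μ slots (λ _ → 1) ⟩
      μ * (∑[ _ ∈ slots ] 1)          ≡⟨ cong (μ *_) (sym (length≡∑ slots)) ⟩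
      μ * length slots                ≡⟨ cong (μ *_) (length-cartesianProductWith _,_ (allFin ν) _) ⟩
      μ * (length (allFin ν) * length (cartesianProduct (shapes d k) (points (suc d))))
        ≡⟨ cong (μ *_) (cong₂ _*_ (length-allFin ν) (trans (length-cartesianProductWith _,_ (shapes d k) _)
             (cong₂ _*_ (trans (length-allVecs (allFin k) d) (cong (_^ d) (length-allFin k))) length-points))) ⟩
      μ * (ν * (k ^ d * P))           ∎
      where open ≡-Reasoning
    n≤L′ : n ≤ length L′
    n≤L′ = ≤-trans n≤ (≤-reflexive (sym length-L′))
    F : Fin n → Box (suc d)
    F i = box {ν = ν} colour (pick L′ n≤L′ i)
    clique : ∀ S → IsClique F S → ∣ S ∣ ≤ μ * (t * b ^ E)
    clique S cl =
      let T , len , adj , sub , _ = select {R = Adj} L′ n≤L′ S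
            (λ i j i∈ j∈ i≢j → intersect⇒adj {ν = ν} colour (pick L′ n≤L′ i) (pick L′ n≤L′ j) (cl i j i∈ j∈ i≢j))
      in subst (_≤ μ * (t * b ^ E)) len
           (clique-bound {t = t} {μ} adj (λ g → ≤-trans (sub g) (≤-reflexive (∑-copies μ slots g))) (proj₁ (proj₂ (colouring d k Q s τ s+s≡Q² 2≤Q 2K≤Q T≤))))
    independent : ∀ S → IsIndependent F S → ∣ S ∣ * b ^ E ≤ 8 * (ν * P)
    independent S ind =
      let T , len , nonadj , _ = select {R = λ σ σ′ → ¬ Adj σ σ′} L′ n≤L′ S
            (λ i j i∈ j∈ i≢j adj → ind i j i∈ j∈ i≢j (adj⇒intersect {ν = ν} colour (pick L′ n≤L′ i) (pick L′ n≤L′ j) adj))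
      in *-cancelʳ-≤′ s 1≤s (begin
        ∣ S ∣ * b ^ E * s             ≡⟨ *-comm _ s ⟩
        s * (∣ S ∣ * b ^ E)           ≡⟨ cong (λ m → s * (m * b ^ E)) (sym len) ⟩
        s * (length T * b ^ E)        ≤⟨ Independent.independent-bound nonadj {s} {τ} 1≤b Ksτ≤ (proj₂ (proj₂ (colouring d k Q s τ s+s≡Q² 2≤Q 2K≤Q T≤))) ⟩
        ν * ((s + s) + (s + s)) * (2 * length (points {b} {suc (d * k)} (suc d)))
          ≡⟨ cong (λ m → ν * ((s + s) + (s + s)) * (2 * m)) length-points ⟩
        ν * ((s + s) + (s + s)) * (2 * P) ≡⟨ lem ν s P ⟩
        8 * (ν * P) * s               ∎)
      where
      open ≤-Reasoning
      1≤b : 1 ≤ b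
      1≤b = 1≤m^n 4 (≤-trans (s≤s z≤n) 2≤Q)
      1≤s : 1 ≤ s
      1≤s = n≢0⇒n>0 λ { refl → <⇒≢ (*-mono-≤ (≤-trans (s≤s z≤n) 2≤Q) (≤-trans (s≤s z≤n) 2≤Q)) s+s≡Q² }
      lem : ∀ ν s P → ν * ((s + s) + (s + s)) * (2 * P) ≡ 8 * (ν * P) * s
      lem = solve-∀

square-cancel-≤ : ∀ {m n} → m * m ≤ n * n → m ≤ n
square-cancel-≤ {m} {n} h with m ≤? n
... | yes m≤n = m≤n
... | no  m≰n = ⊥-elim (<⇒≱ (*-mono-< (≰⇒> m≰n) (≰⇒> m≰n)) h)

√ : ∀ X → ∃ λ m → m * m ≤ X × X < suc m * suc m
√ zero    = 0 , z≤n , s≤s z≤n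
√ (suc X) with m , lo , hi ← √ X | suc m * suc m ≤? suc X
... | yes h = suc m , h , ≤-<-trans hi (*-mono-< (n<1+n (suc m)) (n<1+n (suc m)))
... | no ¬h = m , m≤n⇒m≤1+n lo , ≰⇒> ¬h

scaled-√ : ∀ A X → 1 ≤ A → A ≤ X → ∃ λ ν → 1 ≤ ν × ν * ν * A ≤ X × X ≤ 4 * (ν * ν * A)
scaled-√ A@(suc _) X _ A≤X with √ (X / A)
... | zero  , _  , hi = ⊥-elim (<⇒≱ hi (m≥n⇒m/n>0 A≤X))
... | suc m , lo , hi = suc m , s≤s z≤n
    , ≤-trans (*-monoˡ-≤ A lo) (m/n*n≤m X A)
    , (begin
        X                                       ≤⟨ <⇒≤ (X<[1+X/A]*A X A) ⟩
        suc (X / A) * A                         ≤⟨ *-monoˡ-≤ A hi ⟩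
        suc (suc m) * suc (suc m) * A           ≤⟨ *-monoˡ-≤ A (*-mono-≤ 2+m≤ 2+m≤) ⟩
        2 * suc m * (2 * suc m) * A             ≡⟨ lem (suc m) A ⟩
        4 * (suc m * suc m * A)                 ∎)
  where
  open ≤-Reasoning
  2+m≤ : suc (suc m) ≤ 2 * suc m
  2+m≤ = s≤s (≤-trans (≤-reflexive (sym (+-comm m 1))) (+-monoʳ-≤ m (s≤s z≤n)))
  lem : ∀ m A → 2 * m * (2 * m) * A ≡ 4 * (m * m * A)
  lem = solve-∀
  X<[1+X/A]*A : ∀ X A .{{_ : NonZero A}} → X < suc (X / A) * A
  X<[1+X/A]*A X A = begin-strict
    X                     ≡⟨ m≡m%n+[m/n]*n X A ⟩
    X % A + X / A * A     <⟨ +-monoˡ-< (X / A * A) (m%n<n X A) ⟩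
    A + X / A * A         ∎

-- The family consists of ν disjoint copies of the construction, every box with multiplicity μ;
-- ν is chosen so that the bounds for cliques and independent sets are balanced.
module _ (d k Q s τ n c : ℕ) (s+s≡Q² : s + s ≡ Q * Q) (2≤Q : 2 ≤ Q) (2K≤Q : k ^ d + k ^ d ≤ Q)
  (T≤ : ((s + s) + (s + s)) * (2 ^ ((Q ^ 4) ^ d)) ^ suc d ≤ 2 ^ τ)
  (Ksτ≤ : k ^ d * (s * τ) ≤ (Q ^ 4) ^ suc d)
  (1≤k : 1 ≤ k) (k≤Q : k ≤ Q) (t≤ : 4 * (suc (d * k) * suc d) + 4 ≤ c * k)
  (large : Q * Q * (((Q ^ 4) ^ suc (d * k)) ^ suc d * ((Q ^ 4) ^ suc (d * k)) ^ suc d) ≤ n) where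

  private
    b P e B K A t : ℕ
    b = Q ^ 4
    P = (b ^ suc (d * k)) ^ suc d
    e = b ^ (d * k)
    B = b ^ (suc d + d * k * d)
    K = k ^ d
    -- `B = P / e` is the number of tiles of one shape. The bounds `8 * ν * B` for independent sets
    -- and `2 * n * t / (ν * K * B)` for cliques, with `t` of order `k`, balance when `ν * ν * A` is
    -- of order `n * k`.
    A = K * (B * B)
    t = 4 * (suc (d * k) * suc d) + 4
    1≤Q : 1 ≤ Q
    1≤Q = ≤-trans (s≤s z≤n) 2≤Q
    1≤b : 1 ≤ b
    1≤b = 1≤m^n 4 1≤Q
    1≤e : 1 ≤ e
    1≤e = 1≤m^n (d * k) 1≤b
    1≤B : 1 ≤ B
    1≤B = 1≤m^n (suc d + d * k * d) 1≤b
    1≤K : 1 ≤ K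
    1≤K = 1≤m^n d 1≤k
    K≤Q : K ≤ Q
    K≤Q = ≤-trans (m≤m+n K K) 2K≤Q
    P≡eB : P ≡ e * B
    P≡eB = trans (^-*-assoc b (suc (d * k)) (suc d))
      (trans (cong (b ^_) (lem d k)) (^-distribˡ-+-* b (d * k) (suc d + d * k * d)))
      where
      lem : ∀ d k → suc (d * k) * suc d ≡ d * k + (suc d + d * k * d)
      lem = solve-∀
    e≤P : e ≤ P
    e≤P = ≤-trans (≤-trans (≤-reflexive (sym (*-identityʳ e))) (*-monoʳ-≤ e 1≤B)) (≤-reflexive (sym P≡eB))
    B≤P : B ≤ P
    B≤P = ≤-trans (≤-trans (≤-reflexive (sym (*-identityˡ B))) (*-monoˡ-≤ B 1≤e)) (≤-reflexive (sym P≡eB))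
    1≤n : 1 ≤ n
    1≤n = ≤-trans (*-mono-≤ (*-mono-≤ 1≤Q 1≤Q) (*-mono-≤ (≤-trans 1≤e e≤P) (≤-trans 1≤e e≤P))) large
    A≤ : A ≤ n * k
    A≤ = begin
      K * (B * B)           ≤⟨ *-mono-≤ (≤-trans K≤Q (≤-trans (≤-reflexive (sym (*-identityʳ Q))) (*-monoʳ-≤ Q 1≤Q))) (*-mono-≤ B≤P B≤P) ⟩
      Q * Q * (P * P)       ≤⟨ large ⟩
      n                     ≡⟨ sym (*-identityʳ n) ⟩
      n * 1                 ≤⟨ *-monoʳ-≤ n 1≤k ⟩
      n * k                 ∎
      where open ≤-Reasoning
    balance : ∃ λ ν → 1 ≤ ν × ν * ν * A ≤ n * k × n * k ≤ 4 * (ν * ν * A)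
    balance = scaled-√ A (n * k) (*-mono-≤ 1≤K (*-mono-≤ 1≤B 1≤B)) A≤
    ν N : ℕ
    ν = proj₁ balance
    1≤ν : 1 ≤ ν
    1≤ν = proj₁ (proj₂ balance)
    N = ν * (K * P)
    1≤N : 1 ≤ N
    1≤N = *-mono-≤ 1≤ν (*-mono-≤ 1≤K (≤-trans 1≤e e≤P))
    instance
      N≢0 : NonZero N
      N≢0 = >-nonZero 1≤N
    N≤n : N ≤ n
    -- `N * N` is `ν * ν * A` times `K * e * e`; the first factor is at most `n * k`, and `large`
    -- gives `k * K * e * e ≤ n`. Hence rounding up in `μ` still leaves `μ * N ≤ 2 * n`.
    N≤n = square-cancel-≤ (begin
      N * N                           ≡⟨ cong (λ P → ν * (K * P) * (ν * (K * P))) P≡eB ⟩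
      ν * (K * (e * B)) * (ν * (K * (e * B))) ≡⟨ lem ν K e B ⟩
      ν * ν * A * (K * (e * e))       ≤⟨ *-monoˡ-≤ (K * (e * e)) (proj₁ (proj₂ (proj₂ balance))) ⟩
      n * k * (K * (e * e))           ≡⟨ lem′ n k K (e * e) ⟩
      n * (k * K * (e * e))           ≤⟨ *-monoʳ-≤ n (≤-trans (*-mono-≤ (*-mono-≤ k≤Q K≤Q) (*-mono-≤ e≤P e≤P)) large) ⟩
      n * n                           ∎)
      where
      open ≤-Reasoning
      lem : ∀ ν K e B → ν * (K * (e * B)) * (ν * (K * (e * B))) ≡ ν * ν * (K * (B * B)) * (K * (e * e))
      lem = solve-∀
      lem′ : ∀ n k K e → n * k * (K * e) ≡ n * (k * K * e)
      lem′ = solve-∀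
    μ : ℕ
    μ = suc (n / N)
    n≤μN : n ≤ μ * N
    n≤μN = begin
      n                     ≡⟨ m≡m%n+[m/n]*n n N ⟩
      n % N + n / N * N     ≤⟨ +-monoˡ-≤ (n / N * N) (<⇒≤ (m%n<n n N)) ⟩
      N + n / N * N         ∎
      where open ≤-Reasoning
    μN≤2n : μ * N ≤ 2 * n
    μN≤2n = ≤-trans (+-mono-≤ N≤n (m/n*n≤m n N)) (≤-reflexive (cong (n +_) (sym (+-identityʳ n))))

    C : ℕ
    C = 64 + 16 * (c * c)

    independent-case : ∀ S → S * e ≤ 8 * (ν * P) → S * S * K ≤ C * n * k
    independent-case S h = begin
      S * S * K                          ≤⟨ *-monoˡ-≤ K (*-mono-≤ S≤ S≤) ⟩
      8 * (ν * B) * (8 * (ν * B)) * K    ≡⟨ lem ν B K ⟩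
      64 * (ν * ν * A)                   ≤⟨ *-monoʳ-≤ 64 (proj₁ (proj₂ (proj₂ balance))) ⟩
      64 * (n * k)                       ≤⟨ *-monoˡ-≤ (n * k) (m≤m+n 64 (16 * (c * c))) ⟩
      C * (n * k)                        ≡⟨ sym (*-assoc C n k) ⟩
      C * n * k                          ∎
      where
      open ≤-Reasoning
      S≤ : S ≤ 8 * (ν * B)
      S≤ = *-cancelʳ-≤′ e 1≤e (≤-trans h (≤-reflexive (trans (cong (λ P → 8 * (ν * P)) P≡eB) (lem₀ ν e B))))
        where
        lem₀ : ∀ ν e B → 8 * (ν * (e * B)) ≡ 8 * (ν * B) * e
        lem₀ = solve-∀
      lem : ∀ ν B K → 8 * (ν * B) * (8 * (ν * B)) * K ≡ 64 * (ν * ν * (K * (B * B)))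
      lem = solve-∀

    clique-case : ∀ S → S ≤ μ * (t * e) → S * S * K ≤ C * n * k
    -- After multiplication by `n * k ≤ 4 * ν * ν * A` the left side is at most four times the
    -- square of `S * ν * K * B`, which is at most `t * μ * N`.
    clique-case S h = *-cancelʳ-≤′ (k * n) (*-mono-≤ 1≤k 1≤n) (begin
      S * S * K * (k * n)                     ≡⟨ cong (S * S * K *_) (*-comm k n) ⟩
      S * S * K * (n * k)                     ≤⟨ *-monoʳ-≤ (S * S * K) (proj₂ (proj₂ (proj₂ balance))) ⟩
      S * S * K * (4 * (ν * ν * A))           ≡⟨ lem₁ S K ν B ⟩
      4 * (S * (ν * K * B) * (S * (ν * K * B))) ≤⟨ *-monoʳ-≤ 4 (*-mono-≤ SνKB≤ SνKB≤) ⟩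
      4 * (c * k * (2 * n) * (c * k * (2 * n))) ≡⟨ lem₂ c k n ⟩
      16 * (c * c) * n * k * (k * n)          ≤⟨ *-monoˡ-≤ (k * n) (*-monoˡ-≤ k (*-monoˡ-≤ n (m≤n+m (16 * (c * c)) 64))) ⟩
      C * n * k * (k * n)                     ∎)
      where
      open ≤-Reasoning
      lem₁ : ∀ S K ν B → S * S * K * (4 * (ν * ν * (K * (B * B)))) ≡ 4 * (S * (ν * K * B) * (S * (ν * K * B)))
      lem₁ = solve-∀
      lem₂ : ∀ c k n → 4 * (c * k * (2 * n) * (c * k * (2 * n))) ≡ 16 * (c * c) * n * k * (k * n)
      lem₂ = solve-∀
      lem₃ : ∀ μ t e ν K B → μ * (t * e) * (ν * K * B) ≡ t * (μ * (ν * (K * (e * B))))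
      lem₃ = solve-∀
      SνKB≤ : S * (ν * K * B) ≤ c * k * (2 * n)
      SνKB≤ = begin
        S * (ν * K * B)                       ≤⟨ *-monoˡ-≤ (ν * K * B) h ⟩
        μ * (t * e) * (ν * K * B)             ≡⟨ lem₃ μ t e ν K B ⟩
        t * (μ * (ν * (K * (e * B))))         ≡⟨ cong (λ P → t * (μ * (ν * (K * P)))) (sym P≡eB) ⟩
        t * (μ * N)                           ≤⟨ *-mono-≤ t≤ μN≤2n ⟩
        c * k * (2 * n)                       ∎

  balanced-family : ∃ λ (F : Fin n → Box (suc d)) → (∀ i → IsBox (F i)) ×
    (∀ S → IsClique F S ⊎ IsIndependent F S → ∣ S ∣ * ∣ S ∣ * k ^ d ≤ (64 + 16 * (c * c)) * n * k)
  balanced-family =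
    let F , isBox , clique , independent = boxes d k Q s τ ν μ s+s≡Q² 2≤Q 2K≤Q T≤ Ksτ≤ n≤μN
    in F , isBox , λ { S (inj₁ cl)  → clique-case ∣ S ∣ (clique S cl)
                     ; S (inj₂ ind) → independent-case ∣ S ∣ (independent S ind) }

-- Binary logarithms and the choice of the parameters.

2*⌊n/2⌋≤n : ∀ n → 2 * ⌊ n /2⌋ ≤ n
2*⌊n/2⌋≤n n = begin
  ⌊ n /2⌋ + (⌊ n /2⌋ + 0)   ≡⟨ cong (⌊ n /2⌋ +_) (+-identityʳ _) ⟩
  ⌊ n /2⌋ + ⌊ n /2⌋         ≤⟨ +-monoʳ-≤ ⌊ n /2⌋ (⌊n/2⌋≤⌈n/2⌉ n) ⟩
  ⌊ n /2⌋ + ⌈ n /2⌉         ≡⟨ ⌊n/2⌋+⌈n/2⌉≡n n ⟩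
  n                         ∎
  where open ≤-Reasoning

2^⌊log₂n⌋≤n : ∀ n → 1 ≤ n → 2 ^ ⌊log₂ n ⌋ ≤ n
2^⌊log₂n⌋≤n n 1≤n = bound ⌊log₂ n ⌋ n 1≤n refl
  where
  bound : ∀ l n → 1 ≤ n → ⌊log₂ n ⌋ ≡ l → 2 ^ l ≤ n
  bound zero    n                 1≤n eq = 1≤n
  bound (suc l) (suc zero)        1≤n ()
  bound (suc l) n@(suc (suc _)) 1≤n eq = ≤-trans
    (*-monoʳ-≤ 2 (bound l ⌊ n /2⌋ (s≤s z≤n) (trans (⌊log₂⌊n/2⌋⌋≡⌊log₂n⌋∸1 n) (cong (_∸ 1) eq))))
    (2*⌊n/2⌋≤n n)

n<2^[1+⌊log₂n⌋] : ∀ n → n < 2 ^ suc ⌊log₂ n ⌋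
n<2^[1+⌊log₂n⌋] n = ≰⇒> λ h →
  1+n≰n (≤-trans (≤-reflexive (sym (⌊log₂[2^n]⌋≡n (suc ⌊log₂ n ⌋)))) (⌊log₂⌋-mono-≤ h))

1+15x≤16^x : ∀ x → 1 + 15 * x ≤ 16 ^ x
1+15x≤16^x zero    = ≤-refl
1+15x≤16^x (suc x) = ≤-trans (≤-trans (m≤m+n _ (225 * x)) (≤-reflexive (lem x))) (*-monoʳ-≤ 16 (1+15x≤16^x x))
  where
  lem : ∀ x → 1 + 15 * suc x + 225 * x ≡ 16 * (1 + 15 * x)
  lem = solve-∀

n²≤2*2^n : ∀ n → n * n ≤ 2 * 2 ^ n
n²≤2*2^n 0 = z≤n
n²≤2*2^n 1 = s≤s z≤n
n²≤2*2^n 2 = ≤ᵇ⇒≤ 4 8 tt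
n²≤2*2^n 3 = ≤ᵇ⇒≤ 9 16 tt
n²≤2*2^n (suc n@(suc (suc (suc m)))) = begin
  suc n * suc n                                 ≤⟨ m≤m+n _ (m * m + 4 * m + 2) ⟩
  suc n * suc n + (m * m + 4 * m + 2)           ≡⟨ lem m ⟩
  2 * (n * n)                                   ≤⟨ *-monoʳ-≤ 2 (n²≤2*2^n n) ⟩
  2 * (2 * 2 ^ n)                               ∎
  where
  open ≤-Reasoning
  lem : ∀ m → (4 + m) * (4 + m) + (m * m + 4 * m + 2) ≡ 2 * ((3 + m) * (3 + m))
  lem = solve-∀

module LargeCase (d n k : ℕ) (1≤d : 1 ≤ d) (1≤k : 1 ≤ k) (1≤ℓ : 1 ≤ LL n) (1≤n : 1 ≤ n)
  (k≤ : k * (40 * (suc d * suc d * suc d) * LL n) ≤ L n) where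

  private
    δ ℓ q Q s τ c : ℕ
    δ = suc d
    ℓ = LL n
    -- `Q = 2 ^ q` is a power of log n with exponent about `4 * δ`; this suffices for
    -- `2 * k ^ d ≤ Q` and for `1 + 2 * q + δ ≤ Q`.
    q = 4 * δ * ℓ
    Q = 2 ^ q
    s = 2 ^ pred q * Q
    -- The exact binary logarithm of the number of events in the union bound, as there are
    -- `2 * Q * Q` target colours.
    τ = 1 + q + q + (Q ^ 4) ^ d * δ
    c = 8 * (δ * δ)

    1≤δℓ : 1 ≤ δ * ℓ
    1≤δℓ = *-mono-≤ (s≤s {n = d} z≤n) 1≤ℓ
    q≡ : q ≡ 4 * (δ * ℓ)
    q≡ = *-assoc 4 δ ℓ
    4≤q : 4 ≤ q
    4≤q = ≤-trans (*-monoʳ-≤ 4 1≤δℓ) (≤-reflexive (sym q≡))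
    suc-pred-q : suc (pred q) ≡ q
    suc-pred-q = suc-pred q {{>-nonZero (≤-trans (s≤s z≤n) 4≤q)}}
    Q≡2*2^pred : Q ≡ 2 * 2 ^ pred q
    Q≡2*2^pred = cong (2 ^_) (sym suc-pred-q)
    s+s≡Q² : s + s ≡ Q * Q
    s+s≡Q² = trans (lem (2 ^ pred q) Q) (cong (_* Q) (sym Q≡2*2^pred))
      where
      lem : ∀ p Q → p * Q + p * Q ≡ 2 * p * Q
      lem = solve-∀
    2≤Q : 2 ≤ Q
    2≤Q = ^-monoʳ-≤ 2 (≤-trans (s≤s z≤n) 4≤q)
    1≤Q : 1 ≤ Q
    1≤Q = ≤-trans (s≤s z≤n) 2≤Q

    k≤2^[1+ℓ] : k ≤ 2 ^ suc ℓ
    k≤2^[1+ℓ] = begin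
      k                         ≤⟨ ≤-trans (≤-reflexive (sym (*-identityʳ k))) (*-monoʳ-≤ k (*-mono-≤ (*-mono-≤ {1} {40} (s≤s z≤n) (*-mono-≤ (*-mono-≤ (s≤s {n = d} z≤n) (s≤s {n = d} z≤n)) (s≤s {n = d} z≤n))) 1≤ℓ)) ⟩
      k * (40 * (δ * δ * δ) * ℓ) ≤⟨ k≤ ⟩
      L n                       ≤⟨ <⇒≤ (n<2^[1+⌊log₂n⌋] (L n)) ⟩
      2 ^ suc ℓ                 ∎
      where open ≤-Reasoning
    2K≤Q : k ^ d + k ^ d ≤ Q
    2K≤Q = begin
      k ^ d + k ^ d             ≡⟨ cong (k ^ d +_) (sym (+-identityʳ _)) ⟩
      2 * k ^ d                 ≤⟨ *-monoʳ-≤ 2 (^-monoˡ-≤ d k≤2^[1+ℓ]) ⟩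
      2 * (2 ^ suc ℓ) ^ d       ≡⟨ cong (2 *_) (^-*-assoc 2 (suc ℓ) d) ⟩
      2 ^ (1 + suc ℓ * d)       ≤⟨ ^-monoʳ-≤ 2 exponent ⟩
      2 ^ q                     ∎
      where
      open ≤-Reasoning
      lem : ∀ d ℓ → ℓ + d * ℓ + (ℓ * d + ℓ * d) + (d * ℓ + 3 * ℓ) ≡ 4 * suc d * ℓ
      lem = solve-∀
      exponent : 1 + suc ℓ * d ≤ q
      exponent = begin
        1 + (d + ℓ * d)                                       ≤⟨ +-mono-≤ 1≤ℓ (+-monoˡ-≤ (ℓ * d) (≤-trans (≤-reflexive (sym (*-identityʳ d))) (*-monoʳ-≤ d 1≤ℓ))) ⟩
        ℓ + (d * ℓ + ℓ * d)                                   ≡⟨ sym (+-assoc ℓ (d * ℓ) (ℓ * d)) ⟩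
        ℓ + d * ℓ + ℓ * d                                     ≤⟨ +-monoʳ-≤ (ℓ + d * ℓ) (m≤m+n (ℓ * d) (ℓ * d)) ⟩
        ℓ + d * ℓ + (ℓ * d + ℓ * d)                           ≤⟨ m≤m+n _ (d * ℓ + 3 * ℓ) ⟩
        ℓ + d * ℓ + (ℓ * d + ℓ * d) + (d * ℓ + 3 * ℓ)         ≡⟨ lem d ℓ ⟩
        q                                                     ∎
    k≤Q : k ≤ Q
    k≤Q = ≤-trans k≤k^d (≤-trans (m≤m+n (k ^ d) (k ^ d)) 2K≤Q)
      where
      k≤k^d : k ≤ k ^ d
      k≤k^d = ≤-trans (≤-reflexive (sym (*-identityʳ k))) (^-monoʳ-≤ k {{>-nonZero 1≤k}} 1≤d)

    r+r≡ : (s + s) + (s + s) ≡ 2 ^ (1 + q + q)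
    r+r≡ = trans (cong (λ r → r + r) s+s≡Q²) (trans (cong (Q * Q +_) (sym (+-identityʳ (Q * Q))))
      (cong (2 *_) (sym (^-distribˡ-+-* 2 q q))))
    T≤ : ((s + s) + (s + s)) * (2 ^ ((Q ^ 4) ^ d)) ^ δ ≤ 2 ^ τ
    T≤ = ≤-reflexive (trans (cong₂ _*_ r+r≡ (^-*-assoc 2 ((Q ^ 4) ^ d) δ))
      (sym (^-distribˡ-+-* 2 (1 + q + q) ((Q ^ 4) ^ d * δ))))

    1+2q+δ≤Q : 1 + q + q + δ ≤ Q
    1+2q+δ≤Q = begin
      1 + q + q + δ                 ≤⟨ +-monoʳ-≤ (1 + q + q) (≤-trans (≤-reflexive (sym (*-identityʳ δ))) (*-monoʳ-≤ δ 1≤ℓ)) ⟩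
      1 + q + q + δ * ℓ             ≡⟨ trans (cong (λ q → 1 + q + q + δ * ℓ) q≡) (lem (δ * ℓ)) ⟩
      1 + 9 * (δ * ℓ)               ≤⟨ +-monoʳ-≤ 1 (*-monoˡ-≤ (δ * ℓ) (m≤m+n 9 6)) ⟩
      1 + 15 * (δ * ℓ)              ≤⟨ 1+15x≤16^x (δ * ℓ) ⟩
      16 ^ (δ * ℓ)                  ≡⟨ trans (^-*-assoc 2 4 (δ * ℓ)) (cong (2 ^_) (sym q≡)) ⟩
      Q                             ∎
      where
      open ≤-Reasoning
      lem : ∀ x → 1 + 4 * x + 4 * x + x ≡ 1 + 9 * x
      lem = solve-∀
    -- The factors are at most `Q`, `Q * Q` and `Q * (Q ^ 4) ^ d`; the fourth power of `Q` as the
    -- base is chosen for this.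
    Ksτ≤ : k ^ d * (s * τ) ≤ (Q ^ 4) ^ δ
    Ksτ≤ = begin
      k ^ d * (s * τ)               ≤⟨ *-mono-≤ (≤-trans (m≤m+n (k ^ d) (k ^ d)) 2K≤Q) (*-mono-≤ (≤-trans (m≤m+n s s) (≤-reflexive s+s≡Q²)) τ≤) ⟩
      Q * (Q * Q * (Q * w))         ≡⟨ lem Q w ⟩
      Q ^ 4 * w                     ∎
      where
      open ≤-Reasoning
      w : ℕ
      w = (Q ^ 4) ^ d
      1≤w : 1 ≤ w
      1≤w = 1≤m^n d (1≤m^n 4 1≤Q)
      lem : ∀ Q w → Q * (Q * Q * (Q * w)) ≡ Q * (Q * (Q * (Q * 1))) * w
      lem = solve-∀
      τ≤ : τ ≤ Q * w
      τ≤ = begin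
        1 + q + q + w * δ               ≤⟨ +-monoˡ-≤ (w * δ) (≤-trans (≤-reflexive (sym (*-identityˡ _))) (*-monoˡ-≤ (1 + q + q) 1≤w)) ⟩
        w * (1 + q + q) + w * δ         ≡⟨ sym (*-distribˡ-+ w (1 + q + q) δ) ⟩
        w * (1 + q + q + δ)             ≤⟨ *-monoʳ-≤ w 1+2q+δ≤Q ⟩
        w * Q                           ≡⟨ *-comm w Q ⟩
        Q * w                           ∎

    H≤δk : suc (d * k) ≤ δ * k
    H≤δk = +-monoˡ-≤ (d * k) 1≤k
    1≤δ²k : 1 ≤ δ * δ * k
    1≤δ²k = *-mono-≤ (*-mono-≤ (s≤s {n = d} z≤n) (s≤s {n = d} z≤n)) 1≤k
    Hδ≤δ²k : suc (d * k) * δ ≤ δ * δ * k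
    Hδ≤δ²k = ≤-trans (*-monoˡ-≤ δ H≤δk) (≤-reflexive (lem δ k))
      where
      lem : ∀ δ k → δ * k * δ ≡ δ * δ * k
      lem = solve-∀
    t≤ : 4 * (suc (d * k) * δ) + 4 ≤ c * k
    t≤ = begin
      4 * (suc (d * k) * δ) + 4     ≤⟨ +-mono-≤ (*-monoʳ-≤ 4 Hδ≤δ²k) (*-monoʳ-≤ 4 1≤δ²k) ⟩
      4 * (δ * δ * k) + 4 * (δ * δ * k) ≡⟨ lem (δ * δ) k ⟩
      8 * (δ * δ) * k               ∎
      where
      open ≤-Reasoning
      lem : ∀ a k → 4 * (a * k) + 4 * (a * k) ≡ 8 * a * k
      lem = solve-∀

    -- The product is a power of `Q` with exponent at most `10 * δ * δ * k`; with
    -- `Q = 2 ^ (4 * δ * ℓ)` this gives the constant 40 in `k≤`.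
    large : Q * Q * (((Q ^ 4) ^ suc (d * k)) ^ δ * ((Q ^ 4) ^ suc (d * k)) ^ δ) ≤ n
    large = begin
      Q * Q * (((Q ^ 4) ^ suc (d * k)) ^ δ * ((Q ^ 4) ^ suc (d * k)) ^ δ)
        ≡⟨ cong (λ P → Q * Q * (P * P)) (trans (^-*-assoc (Q ^ 4) (suc (d * k)) δ) (^-*-assoc Q 4 (suc (d * k) * δ))) ⟩
      Q * Q * (Q ^ x * Q ^ x)
        ≡⟨ trans (*-assoc Q Q _) (cong (λ m → Q * (Q * m)) (sym (^-distribˡ-+-* Q x x))) ⟩
      Q ^ (2 + (x + x))
        ≡⟨ ^-*-assoc 2 q (2 + (x + x)) ⟩
      2 ^ (q * (2 + (x + x)))
        ≤⟨ ^-monoʳ-≤ 2 (≤-trans exponent k≤) ⟩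
      2 ^ L n
        ≤⟨ 2^⌊log₂n⌋≤n n 1≤n ⟩
      n ∎
      where
      open ≤-Reasoning
      x : ℕ
      x = 4 * (suc (d * k) * δ)
      lem : ∀ δ k ℓ → 4 * δ * ℓ * (2 * (δ * δ * k) + (4 * (δ * δ * k) + 4 * (δ * δ * k))) ≡ k * (40 * (δ * δ * δ) * ℓ)
      lem = solve-∀
      exponent : q * (2 + (x + x)) ≤ k * (40 * (δ * δ * δ) * ℓ)
      exponent = begin
        q * (2 + (x + x))
          ≤⟨ *-monoʳ-≤ q (+-mono-≤ (*-monoʳ-≤ 2 1≤δ²k) (+-mono-≤ (*-monoʳ-≤ 4 Hδ≤δ²k) (*-monoʳ-≤ 4 Hδ≤δ²k))) ⟩
        q * (2 * (δ * δ * k) + (4 * (δ * δ * k) + 4 * (δ * δ * k)))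
          ≡⟨ lem δ k ℓ ⟩
        k * (40 * (δ * δ * δ) * ℓ) ∎

  large-family : ∃ λ (F : Fin n → Box (suc d)) → (∀ i → IsBox (F i)) ×
    (∀ S → IsClique F S ⊎ IsIndependent F S → ∣ S ∣ * ∣ S ∣ * k ^ d ≤ (64 + 16 * (8 * (suc d * suc d) * (8 * (suc d * suc d)))) * n * k)
  large-family = balanced-family d k Q s τ n c s+s≡Q² 2≤Q 2K≤Q T≤ Ksτ≤ 1≤k k≤Q t≤ large

-- All n at least 4: bounded n, and k of order log n / log log n.

module _ (m C₁ C₂ : ℕ) (1≤C₁ : 1 ≤ C₁)
  (large-family : ∀ n k → 1 ≤ k → 1 ≤ LL n → 1 ≤ n → k * (C₁ * LL n) ≤ L n →
    ∃ λ (F : Fin n → Box (suc (suc m))) → (∀ i → IsBox (F i)) ×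
      (∀ S → IsClique F S ⊎ IsIndependent F S → ∣ S ∣ * ∣ S ∣ * k ^ suc m ≤ C₂ * n * k)) where

  private
    Λ C : ℕ
    Λ = C₁ * (C₁ + C₁)
    C = (2 * C₁) ^ m * C₂ + 2 ^ suc Λ * Λ ^ m

    Family : ℕ → Set
    Family n = Σ (Fin n → Box (suc (suc m))) λ F → ((i : Fin n) → IsBox (F i)) ×
      ((S : Subset n) → IsClique F S ⊎ IsIndependent F S →
      (∣ S ∣ * ∣ S ∣) * (L n ^ m) ≤ C * n * (LL n ^ m))

  module _ (n : ℕ) (4≤n : 4 ≤ n) where

    1≤n : 1 ≤ n
    1≤n = ≤-trans (s≤s z≤n) 4≤n
    1≤ℓ : 1 ≤ LL n
    1≤ℓ = ⌊log₂⌋-mono-≤ (⌊log₂⌋-mono-≤ 4≤n)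
    1≤λ : 1 ≤ L n
    1≤λ = ⌊log₂⌋-mono-≤ (≤-trans (s≤s (s≤s z≤n)) 4≤n)

    -- With `ℓ = LL n`, the chain `ℓ * ℓ ≤ 2 * 2 ^ ℓ ≤ 2 * C₁ * ℓ` bounds `ℓ`, hence `L n ≤ Λ`, and
    -- `n` itself is bounded. The trivial bound `n` is then absorbed by `C`, and all boxes may be
    -- the same point.
    small : L n < C₁ * LL n → Family n
    small λ<C₁ℓ = (λ _ _ → ℤ.0ℤ , ℤ.0ℤ) , (λ _ _ → ℤ.≤-refl) , λ S _ → begin
      ∣ S ∣ * ∣ S ∣ * L n ^ m          ≤⟨ *-mono-≤ (*-mono-≤ (∣p∣≤n S) (∣p∣≤n S)) (^-monoˡ-≤ m λ≤Λ) ⟩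
      n * n * Λ ^ m                    ≤⟨ *-monoˡ-≤ (Λ ^ m) (*-monoʳ-≤ n (≤-trans (<⇒≤ (n<2^[1+⌊log₂n⌋] n)) (^-monoʳ-≤ 2 (s≤s λ≤Λ)))) ⟩
      n * 2 ^ suc Λ * Λ ^ m            ≡⟨ lem n (2 ^ suc Λ) (Λ ^ m) ⟩
      2 ^ suc Λ * Λ ^ m * n            ≤⟨ *-monoˡ-≤ n (m≤n+m (2 ^ suc Λ * Λ ^ m) ((2 * C₁) ^ m * C₂)) ⟩
      C * n                            ≡⟨ sym (*-identityʳ (C * n)) ⟩
      C * n * 1                        ≤⟨ *-monoʳ-≤ (C * n) (1≤m^n m 1≤ℓ) ⟩
      C * n * LL n ^ m                 ∎
      where
      open ≤-Reasoning
      lem : ∀ n a b → n * a * b ≡ a * b * n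
      lem = solve-∀
      lem′ : ∀ a ℓ → 2 * (a * ℓ) ≡ (a + a) * ℓ
      lem′ = solve-∀
      ℓ≤ : LL n ≤ C₁ + C₁
      ℓ≤ = *-cancelʳ-≤′ (LL n) 1≤ℓ (begin
        LL n * LL n                    ≤⟨ n²≤2*2^n (LL n) ⟩
        2 * 2 ^ LL n                   ≤⟨ *-monoʳ-≤ 2 (≤-trans (2^⌊log₂n⌋≤n (L n) 1≤λ) (<⇒≤ λ<C₁ℓ)) ⟩
        2 * (C₁ * LL n)                ≡⟨ lem′ C₁ (LL n) ⟩
        (C₁ + C₁) * LL n               ∎)
      λ≤Λ : L n ≤ Λ
      λ≤Λ = ≤-trans (<⇒≤ λ<C₁ℓ) (*-monoʳ-≤ C₁ ℓ≤)

    instance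
      C₁ℓ≢0 : NonZero (C₁ * LL n)
      C₁ℓ≢0 = >-nonZero (*-mono-≤ 1≤C₁ 1≤ℓ)

    -- The largest value that `large-family` admits.
    k : ℕ
    k = L n / (C₁ * LL n)

    large : 1 ≤ k → Family n
    large 1≤k =
      let F , isBox , bound = large-family n k 1≤k 1≤ℓ 1≤n (m/n*n≤m (L n) (C₁ * LL n))
      in F , isBox , λ S h → convert ∣ S ∣ (bound S h)
      where
      open ≤-Reasoning
      λ≤ : L n ≤ 2 * C₁ * (LL n * k)
      λ≤ = begin
        L n                                       ≡⟨ m≡m%n+[m/n]*n (L n) (C₁ * LL n) ⟩
        L n % (C₁ * LL n) + k * (C₁ * LL n)       ≤⟨ +-monoˡ-≤ (k * (C₁ * LL n)) (≤-trans (<⇒≤ (m%n<n (L n) (C₁ * LL n))) (≤-trans (≤-reflexive (sym (*-identityˡ _))) (*-monoˡ-≤ (C₁ * LL n) 1≤k))) ⟩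
        k * (C₁ * LL n) + k * (C₁ * LL n)         ≡⟨ lem k C₁ (LL n) ⟩
        2 * C₁ * (LL n * k)                       ∎
        where
        lem : ∀ k c ℓ → k * (c * ℓ) + k * (c * ℓ) ≡ 2 * c * (ℓ * k)
        lem = solve-∀
      -- `L n` is replaced by `2 * C₁ * (LL n * k)`. The factor `k` lost in the bound cancels one
      -- power of `k`, which leaves the exponent `m`, two less than the dimension.
      convert : ∀ S → S * S * k ^ suc m ≤ C₂ * n * k → S * S * L n ^ m ≤ C * n * LL n ^ m
      convert S h = begin
        S * S * L n ^ m                           ≤⟨ *-monoʳ-≤ (S * S) (^-monoˡ-≤ m λ≤) ⟩
        S * S * (2 * C₁ * (LL n * k)) ^ m         ≡⟨ cong (S * S *_) (trans (^-distribʳ-* m (2 * C₁) (LL n * k)) (cong ((2 * C₁) ^ m *_) (^-distribʳ-* m (LL n) k))) ⟩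
        S * S * ((2 * C₁) ^ m * (LL n ^ m * k ^ m)) ≡⟨ lem₁ (S * S) ((2 * C₁) ^ m) (LL n ^ m) (k ^ m) ⟩
        (2 * C₁) ^ m * LL n ^ m * (S * S * k ^ m) ≤⟨ *-monoʳ-≤ ((2 * C₁) ^ m * LL n ^ m) cancelled ⟩
        (2 * C₁) ^ m * LL n ^ m * (C₂ * n)        ≡⟨ lem₂ ((2 * C₁) ^ m) (LL n ^ m) C₂ n ⟩
        (2 * C₁) ^ m * C₂ * n * LL n ^ m          ≤⟨ *-monoˡ-≤ (LL n ^ m) (*-monoˡ-≤ n (m≤m+n ((2 * C₁) ^ m * C₂) (2 ^ suc Λ * Λ ^ m))) ⟩
        C * n * LL n ^ m                          ∎
        where
        lem₁ : ∀ s c ℓ k → s * (c * (ℓ * k)) ≡ c * ℓ * (s * k)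
        lem₁ = solve-∀
        lem₂ : ∀ c ℓ a n → c * ℓ * (a * n) ≡ c * a * n * ℓ
        lem₂ = solve-∀
        cancelled : S * S * k ^ m ≤ C₂ * n
        cancelled = *-cancelʳ-≤′ k 1≤k (≤-trans
          (≤-reflexive (trans (*-assoc (S * S) (k ^ m) k) (cong (S * S *_) (*-comm (k ^ m) k)))) h)

    family : Family n
    family with L n <? C₁ * LL n
    ... | yes λ<C₁ℓ = small λ<C₁ℓ
    ... | no  λ≮C₁ℓ = large (m≥n⇒m/n>0 (≮⇒≥ λ≮C₁ℓ))

  families : Σ ℕ λ C → ∀ n → 4 ≤ n →
    Σ (Fin n → Box (suc (suc m))) λ F → ((i : Fin n) → IsBox (F i)) ×
      ((S : Subset n) → IsClique F S ⊎ IsIndependent F S →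
      (∣ S ∣ * ∣ S ∣) * (L n ^ m) ≤ C * n * (LL n ^ m))
  families = C , family

theorem2 : (d : ℕ) → 3 ≤ d →
    Σ ℕ λ C → (n : ℕ) → 4 ≤ n →
    Σ (Fin n → Box d) λ F →
    ((i : Fin n) → IsBox (F i)) ×
    ((S : Subset n) → IsClique F S ⊎ IsIndependent F S →
    (∣ S ∣ * ∣ S ∣) * (L n ^ (d ∸ 2)) ≤ C * n * (LL n ^ (d ∸ 2)))
theorem2 (suc (suc m@(suc _))) _ =
  -- `δ` is the dimension, while the construction is parametrised by `suc m`, one less. The second
  -- constant is `64 + 16 * (c * c)` with `c = 8 * (δ * δ)`.
  families m (40 * (δ * δ * δ)) (64 + 16 * (8 * (δ * δ) * (8 * (δ * δ)))) (s≤s z≤n)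
        (λ n k 1≤k → LargeCase.large-family (suc m) n k (s≤s z≤n) 1≤k)
  where
  δ : ℕ
  δ = suc (suc m)
theorem2 (suc zero)       (s≤s ())
theorem2 (suc (suc zero)) (s≤s (s≤s ()))
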